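{- For every $n\ge1$, the map $f\colon\mathcal{T}_n(P,e)\to\mathcal{M}'_{n-1}(Z)$ is a bijection in each of the following three cases: (i) $(P,e)=(21435,1111)$, $Z=\{\mathtt U\mathtt U\}$; (ii) $(P,e)=(42135,1111)$, $Z=\{\mathtt D\mathtt U\}$; (iii) $(P,e)=(13254,1111)$, $Z=\{\mathtt U,\mathtt F_R\}\times\{\mathtt U\}\times\{\mathtt U,\mathtt F_L\}=\{\mathtt{UUU},\mathtt{UUF}_L,\mathtt F_R\mathtt{UU},\mathtt F_R\mathtt U\mathtt F_L\}$. Moreover, $(21435,1111)=(21435,\text{ - }1\text{ - }\text{ - })$, $(42135,1111)=(42135,1\text{ - }\text{ - }\text{ - })$ and $(13254,1111)=(13254,1\text{ - }1\text{ - })$, in the sense that the set of avoiding trees does not change when the entries marked "-" are replaced by arbitrary values in $\{0,1\}$. Furthermore, for each $n\ge1$ these three sets of Motzkin paths have the same cardinality, and these cardinalities form the sequence OEIS A159771, whose terms for $n=1,2,3,\dots$ are $1,2,5,14,41,124,385,1220,3929,12822,\dots$.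
   Context: $\mathcal{T}_n$ is the set of binary trees on $n$ vertices labeled $1,\dots,n$ by the search tree property; $r(T)$ root, $L(T),R(T)$ left and right subtrees of the root, $c_L,c_R,p$ left child, right child, parent. A tree pattern is $(P,e)$, $P\in\mathcal{T}_k$, $e\colon[k]\setminus\{r(P)\}\to\{0,1\}$; $T$ contains $(P,e)$ if there is an injection $f\colon[k]\to[n]$ such that for each non-root $i$ of $P$: if $e(i)=1$, $f(i)$ is the left (resp. right) child of $f(p(i))$ when $i$ is the left (resp. right) child of $p(i)$; if $e(i)=0$, $f(i)$ lies in the left (resp. right) subtree of $f(p(i))$. $\mathcal{T}_n(P,e)$ is the set of avoiders. Compact notation: $(\tau_1\cdots\tau_k,\,x_2\cdots x_k)$ denotes the pattern with preorder sequence (root, left subtree recursively, right subtree recursively) $\tau_1,\dots,\tau_k$ and $e(\tau_j)=x_j$. Motzkin paths with 2-colored flat steps: words over $\{\mathtt U,\mathtt D,\mathtt F_L,\mathtt F_R\}$ with $\mathtt U=(1,1)$, $\mathtt D=(1,-1)$, $\mathtt F_L,\mathtt F_R=(1,0)$, from $(0,0)$ back to the $x$-axis, never below it; $\mathcal{M}'_m$ is the set of those with $m$ steps and $\mathcal{M}'_m(Z)$ those avoiding every word of $Z$ as a consecutive substring. The map $f$: if $r(T)$ has no children, $f(T)$ is empty; only a left child: $f(T)=\mathtt F_L f(L(T))$; only a right child: $f(T)=\mathtt F_R f(R(T))$; two children: $f(T)=\mathtt U f(R(T))\mathtt D f(L(T))$. -}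

module Defs where

open import Level using (Level)
open import Data.Bool using (if_then_else_)
open import Data.Fin using (Fin)
open import Data.Fin.Patterns using (0F; 1F)
open import Data.Integer as ℤ using (ℤ; 0ℤ; 1ℤ; -1ℤ)
open import Data.List using (List; []; _∷_; _++_; length; map; foldr; upTo; drop)
open import Data.List.Membership.Propositional using (_∈_)
open import Data.List.Relation.Binary.Infix.Heterogeneous using (Infix)
open import Data.List.Relation.Unary.All using (All; all?)
open import Data.Nat using (ℕ; zero; suc; _+_; _*_; _∸_; _≤_; _<_; _≡ᵇ_)
open import Data.Nat.ListAction using (sum)
open import Data.Nat.Properties using (_≟_; _≤?_; _<?_)
open import Data.Product using (_×_; ∃-syntax; Σ-syntax)
open import Data.Unit using (⊤; tt)
open import Relation.Binary.PropositionalEquality using (_≡_; refl)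
open import Relation.Nullary using (¬_; Dec; yes)
open import Relation.Nullary.Decidable using (_×-dec_; from-yes)
open import Relation.Unary using (Pred)

private
  variable
    a b p q : Level
    A : Set a
    B : Set b

MapsTo : (A → B) → Pred A p → Pred B q → Set _
MapsTo f P Q = ∀ x → P x → Q (f x)

InjectiveOn : (A → B) → Pred A p → Set _
InjectiveOn f P = ∀ x y → P x → P y → f x ≡ f y → x ≡ y

SurjectiveOn : (A → B) → Pred A p → Pred B q → Set _
SurjectiveOn {A = A} f P Q = ∀ y → Q y → Σ[ x ∈ A ] P x × f x ≡ y

BijectiveOn : (A → B) → Pred A p → Pred B q → Set _
BijectiveOn f P Q = MapsTo f P Q × InjectiveOn f P × SurjectiveOn f P Q

HasCardinality : Pred A p → ℕ → Set _
HasCardinality {A = A} P k = Σ[ g ∈ (Fin k → A) ] BijectiveOn g (λ _ → ⊤) P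

data Tree : Set where
  ∅    : Tree
  node : (left : Tree) (label : ℕ) (right : Tree) → Tree

inorder : Tree → List ℕ
inorder ∅            = []
inorder (node l x r) = inorder l ++ x ∷ inorder r

preorder : Tree → List ℕ
preorder ∅            = []
preorder (node l x r) = x ∷ preorder l ++ preorder r

_∈ᵗ_ : ℕ → Tree → Set
i ∈ᵗ T = i ∈ inorder T

SearchTree : Tree → Set
SearchTree ∅            = ⊤
SearchTree (node l x r) =
  All (_< x) (inorder l) × All (x <_) (inorder r) × SearchTree l × SearchTree r

-- The search tree property makes the labels distinct, so n vertices with
-- labels in {1,…,n} use each of 1,…,n exactly once.
𝒯 : ℕ → Pred Tree _
𝒯 n T = SearchTree T × length (inorder T) ≡ n × All (λ i → 1 ≤ i × i ≤ n) (inorder T)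

searchTree? : ∀ T → Dec (SearchTree T)
searchTree? ∅            = yes tt
searchTree? (node l x r) =
  all? (_<? x) (inorder l) ×-dec all? (x <?_) (inorder r)
    ×-dec searchTree? l ×-dec searchTree? r

𝒯? : ∀ n T → Dec (𝒯 n T)
𝒯? n T = searchTree? T ×-dec (length (inorder T) ≟ n)
  ×-dec all? (λ i → (1 ≤? i) ×-dec (i ≤? n)) (inorder T)

-- S ⊴ T: S is the subtree of T rooted at some vertex of T, or is empty.
data _⊴_ (S : Tree) : Tree → Set where
  here  : S ⊴ S
  left  : ∀ {l x r} → S ⊴ l → S ⊴ node l x r
  right : ∀ {l x r} → S ⊴ r → S ⊴ node l x r

-- In each of these relations, j is the left/right child of i, respectively
-- lies in the left/right subtree of i.

IsLeftChild : Tree → ℕ → ℕ → Set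
IsLeftChild T j i = ∃[ l ] ∃[ r ] ∃[ s ] node (node l j r) i s ⊴ T

IsRightChild : Tree → ℕ → ℕ → Set
IsRightChild T j i = ∃[ s ] ∃[ l ] ∃[ r ] node s i (node l j r) ⊴ T

InLeftSubtree : Tree → ℕ → ℕ → Set
InLeftSubtree T j i = ∃[ l ] ∃[ r ] (node l i r ⊴ T) × j ∈ᵗ l

InRightSubtree : Tree → ℕ → ℕ → Set
InRightSubtree T j i = ∃[ l ] ∃[ r ] (node l i r ⊴ T) × j ∈ᵗ r

-- Only the values of e at non-root labels of the tree are ever used.
record Pattern (k : ℕ) : Set where
  field
    tree   : Tree
    tree∈𝒯 : 𝒯 k tree
    e      : ℕ → Fin 2

-- The quantification over all non-root i is over all pairs (i , p) with i a
-- left or right child of p in the pattern.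
record Contains {k : ℕ} (T : Tree) (π : Pattern k) : Set where
  open Pattern π
  field
    f           : ℕ → ℕ
    f-maps      : MapsTo f (_∈ᵗ tree) (_∈ᵗ T)
    f-injective : InjectiveOn f (_∈ᵗ tree)
    left-1      : ∀ i p → IsLeftChild  tree i p → e i ≡ 1F → IsLeftChild    T (f i) (f p)
    right-1     : ∀ i p → IsRightChild tree i p → e i ≡ 1F → IsRightChild   T (f i) (f p)
    left-0      : ∀ i p → IsLeftChild  tree i p → e i ≡ 0F → InLeftSubtree  T (f i) (f p)
    right-0     : ∀ i p → IsRightChild tree i p → e i ≡ 0F → InRightSubtree T (f i) (f p)

𝒯-avoiding : ∀ {k} → ℕ → Pattern k → Pred Tree _
𝒯-avoiding n π T = 𝒯 n T × ¬ Contains T π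

assign : List ℕ → List (Fin 2) → ℕ → Fin 2
assign (t ∷ ts) (x ∷ xs) i = if t ≡ᵇ i then x else assign ts xs i
assign _        _        _ = 0F

-- The pattern (τ₁⋯τₖ , x₂⋯xₖ), where τ₁,…,τₖ is the preorder sequence of P.
compact : ∀ {k} (P : Tree) → 𝒯 k P → List (Fin 2) → Pattern k
compact P P∈𝒯 xs = record { tree = P ; tree∈𝒯 = P∈𝒯 ; e = assign (drop 1 (preorder P)) xs }

private
  leaf : ℕ → Tree
  leaf i = node ∅ i ∅

P21435 P42135 P13254 : Tree
P21435 = node (leaf 1) 2 (node (leaf 3) 4 (leaf 5))
P42135 = node (node (leaf 1) 2 (leaf 3)) 4 (leaf 5)
P13254 = node ∅ 1 (node (leaf 2) 3 (node (leaf 4) 5 ∅))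

_ : preorder P21435 ≡ 2 ∷ 1 ∷ 4 ∷ 3 ∷ 5 ∷ []
_ = refl

_ : preorder P42135 ≡ 4 ∷ 2 ∷ 1 ∷ 3 ∷ 5 ∷ []
_ = refl

_ : preorder P13254 ≡ 1 ∷ 3 ∷ 2 ∷ 5 ∷ 4 ∷ []
_ = refl

⟨21435,_⟩ ⟨42135,_⟩ ⟨13254,_⟩ : List (Fin 2) → Pattern 5
⟨21435, xs ⟩ = compact P21435 (from-yes (𝒯? 5 P21435)) xs
⟨42135, xs ⟩ = compact P42135 (from-yes (𝒯? 5 P42135)) xs
⟨13254, xs ⟩ = compact P13254 (from-yes (𝒯? 5 P13254)) xs

1111F : List (Fin 2)
1111F = 1F ∷ 1F ∷ 1F ∷ 1F ∷ []

data Step : Set where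
  U D Fᴸ Fᴿ : Step

rise : Step → ℤ
rise U  = 1ℤ
rise D  = -1ℤ
rise Fᴸ = 0ℤ
rise Fᴿ = 0ℤ

height : List Step → ℤ
height = foldr (λ s h → rise s ℤ.+ h) 0ℤ

IsMotzkin : Pred (List Step) _
IsMotzkin w = height w ≡ 0ℤ × (∀ u v → w ≡ u ++ v → 0ℤ ℤ.≤ height u)

ℳ′ : ℕ → Pred (List Step) _
ℳ′ m w = length w ≡ m × IsMotzkin w

ℳ′-avoiding : ℕ → List (List Step) → Pred (List Step) _
ℳ′-avoiding m Z w = ℳ′ m w × (∀ z → z ∈ Z → ¬ Infix _≡_ z w)

Z₁ Z₂ Z₃ : List (List Step)
Z₁ = (U ∷ U ∷ []) ∷ []
Z₂ = (D ∷ U ∷ []) ∷ []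
Z₃ = (U ∷ U ∷ U ∷ []) ∷ (U ∷ U ∷ Fᴸ ∷ []) ∷ (Fᴿ ∷ U ∷ U ∷ []) ∷ (Fᴿ ∷ U ∷ Fᴸ ∷ []) ∷ []

-- The value at ∅ is a junk value: the map is only considered on nonempty trees.
toMotzkin : Tree → List Step
toMotzkin ∅                                    = []
toMotzkin (node ∅ _ ∅)                         = []
toMotzkin (node l@(node _ _ _) _ ∅)            = Fᴸ ∷ toMotzkin l
toMotzkin (node ∅ _ r@(node _ _ _))            = Fᴿ ∷ toMotzkin r
toMotzkin (node l@(node _ _ _) _ r@(node _ _ _)) = U ∷ toMotzkin r ++ D ∷ toMotzkin l

Series : Set
Series = ℕ → ℕ

poly : List ℕ → Series
poly []       _       = 0
poly (c ∷ _)  zero    = c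
poly (_ ∷ cs) (suc n) = poly cs n

_⊕_ _⊛_ : Series → Series → Series
(f ⊕ g) n = f n + g n
(f ⊛ g) n = sum (map (λ i → f i * g (n ∸ i)) (upTo (suc n)))

-- A159771 counts the n-leaf binary trees avoiding a certain 6-leaf tree.
-- Its generating function is algebraic: h = Σ_{n≥1} A159771(n) xⁿ satisfies
--   2x h² − (1 − 2x + 3x²) h + x − x² + x³ = 0.
-- Counting trees by their n ≥ 1 internal vertices instead (n + 1 leaves), that
-- is, writing h = x + x f, turns this into
--   f = x + (2x + x²) f + 2x² f²,
-- which determines f: the coefficient of xⁿ on the right-hand side only
-- involves coefficients of f below n.
IsA159771 : Series → Set
IsA159771 f = ∀ n → f n ≡
  (poly (0 ∷ 1 ∷ []) ⊕ ((poly (0 ∷ 2 ∷ 1 ∷ []) ⊛ f) ⊕ (poly (0 ∷ 0 ∷ 2 ∷ []) ⊛ (f ⊛ f)))) n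

{-# OPTIONS --safe #-}
-- A search tree on 1,…,n is determined by its shape, and the recursion for f is
-- the first-return decomposition of a 2-coloured Motzkin path read off the
-- shape, so f is a bijection onto all paths.  A containment of any of the
-- patterns, whatever the free entries of e, amounts to a local configuration of
-- children at some vertex (having a descendant on one side is the same as having
-- a child there), and these configurations are exactly the forbidden factors.
-- Peeling off the root, each of the three classes has generating function
-- G = x(1 + 2G)(1 + xG); each decomposition is made bijective onto one family of
-- codes, which is then counted.
module Submission where

open import Defs
open import Data.Empty using (⊥)
open import Data.Fin using (Fin)
open import Data.Fin.Patterns using (0F; 1F)
open import Data.Fin.Properties using (0↔⊥; 1↔⊤; +↔⊎; *↔×)
open import Data.Integer as ℤ using (ℤ; 0ℤ)
import Data.Integer.Properties as ℤ
open import Data.List using (List; []; _∷_; _++_; length; applyUpTo)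
open import Data.List.Membership.Propositional using (_∈_)
open import Data.List.Membership.Propositional.Properties using (∈-++⁺ˡ; ∈-++⁺ʳ; ∈-++⁻)
open import Data.List.Properties using (length-++; ++-assoc; ++-identityʳ; ∷-injectiveʳ; map-upTo)
open import Data.List.Relation.Binary.Infix.Heterogeneous using (Infix; here; there)
open import Data.List.Relation.Binary.Prefix.Heterogeneous using (Prefix; []; _∷_)
open import Data.List.Relation.Unary.All as All using (All; []; _∷_)
import Data.List.Relation.Unary.All.Properties as All
open import Data.List.Relation.Unary.Any using (here; there)
open import Data.Nat using (ℕ; zero; suc; _+_; _*_; _∸_; _≤_; _<_; z≤n; s≤s; s≤s⁻¹)
open import Data.Nat.Induction using (<-rec)
open import Data.Nat.ListAction using (sum)
open import Data.Nat.Properties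
open import Data.Nat.Tactic.RingSolver using (solve-∀)
open import Data.Product using (_×_; _,_; proj₁; proj₂; Σ-syntax; ∃-syntax)
open import Data.Product.Function.NonDependent.Propositional using (_×-↔_)
open import Data.Sum using (_⊎_; inj₁; inj₂; [_,_]′)
open import Data.Sum.Function.Propositional using (_⊎-↔_)
open import Data.Unit using (⊤; tt)
open import Data.Vec using (Vec; []; _∷_)
open import Function using (_∘_)
open import Function.Bundles using (_⇔_; mk⇔; Equivalence; _↔_; mk↔ₛ′; Inverse)
open import Function.Properties.Inverse using (↔-sym; ↔-trans)
open import Relation.Binary.PropositionalEquality using (_≡_; refl; sym; trans; cong; cong₂; subst; module ≡-Reasoning)
open import Relation.Nullary using (¬_; contradiction)

-- Shapes and the labelled trees they determine

-- A `Shape` is a nonempty tree with its labels erased, with one constructor for each case of the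
-- map to paths; n vertices give a word of n - 1 letters. The free entries of `e` need no argument
-- of their own: every variant of a pattern is proved equivalent to one and the same predicate on
-- shapes. On the side of words, a factor may run past the end of the word of a subtree, so the
-- statements are about `word s ++ u`, with u empty or starting with `D`. The equation for G is the
-- one in `IsA159771`, factored: x(1 + 2G)(1 + xG) = x + (2x + x²)G + 2x²G². In the first two
-- classes the factors are read off the root and one of its children. The third class resists this,
-- because a subtree on a right edge obeys a stricter condition than one on a left edge; there
-- subtrees have to be rearranged.

data Shape : Set where
  leaf  : Shape
  ll rr : Shape → Shape
  bin   : (l r : Shape) → Shape

size : Shape → ℕ
size leaf      = 1
size (ll s)    = suc (size s)
size (rr s)    = suc (size s)
size (bin l r) = suc (size l + size r)

-- The value at ∅ is junk, as for toMotzkin.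
shape : Tree → Shape
shape ∅                                        = leaf
shape (node ∅ _ ∅)                             = leaf
shape (node l@(node _ _ _) _ ∅)                = ll (shape l)
shape (node ∅ _ r@(node _ _ _))                = rr (shape r)
shape (node l@(node _ _ _) _ r@(node _ _ _))   = bin (shape l) (shape r)

data NonEmpty : Tree → Set where
  nonEmpty : ∀ {l x r} → NonEmpty (node l x r)

#_ : Tree → ℕ
# T = length (inorder T)

#-node : ∀ l x r → # (node l x r) ≡ suc (# l + # r)
#-node l x r = trans (length-++ (inorder l)) (+-suc (# l) (# r))

#≡size : ∀ {T} → NonEmpty T → # T ≡ size (shape T)
#≡size {node ∅ _ ∅} nonEmpty = refl
#≡size {node l@(node _ _ _) x ∅} nonEmpty = trans (#-node l x ∅)
  (cong suc (trans (+-identityʳ (# l)) (#≡size nonEmpty)))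
#≡size {node ∅ _ r@(node _ _ _)} nonEmpty = cong suc (#≡size nonEmpty)
#≡size {node l@(node _ _ _) x r@(node _ _ _)} nonEmpty = trans (#-node l x r)
  (cong suc (cong₂ _+_ (#≡size {l} nonEmpty) (#≡size {r} nonEmpty)))

nonEmpty-# : ∀ {T} → 1 ≤ # T → NonEmpty T
nonEmpty-# {node _ _ _} _ = nonEmpty

-- Inorder numbering with a + 1, a + 2, ...; the old labels are discarded, so the result depends on
-- the shape alone.
relabel : ℕ → Tree → Tree
relabel a ∅            = ∅
relabel a (node l _ r) = node (relabel a l) (suc (a + # l)) (relabel (suc (a + # l)) r)

-- Half-open intervals: the root label y + 1 splits (a, b] into (a, y] and (y + 1, b], and
-- `Labels 0 n` unfolds to the bound in `𝒯 n`.
Labels : ℕ → ℕ → Tree → Set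
Labels a b T = All (λ i → a < i × i ≤ b) (inorder T)

labels-widen : ∀ {a a′ b b′} T → a′ ≤ a → b ≤ b′ → Labels a b T → Labels a′ b′ T
labels-widen T a′≤a b≤b′ = All.map λ (a<i , i≤b) → ≤-<-trans a′≤a a<i , ≤-trans i≤b b≤b′

labels-node⁻ : ∀ {a b} l y r → SearchTree (node l (suc y) r) → Labels a b (node l (suc y) r) →
               Labels a y l × (a ≤ y × suc y ≤ b) × Labels (suc y) b r
labels-node⁻ l y r (l< , <r , _) lab with All.++⁻ˡ (inorder l) lab | All.++⁻ʳ (inorder l) lab
... | lab-l | (a<x , x≤b) ∷ lab-r =
  All.zipWith (λ ((a<i , _) , i<x) → a<i , s≤s⁻¹ i<x) (lab-l , l<) ,
  (s≤s⁻¹ a<x , x≤b) ,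
  All.zipWith (λ ((_ , i≤b) , x<i) → x<i , i≤b) (lab-r , <r)

+-#-node : ∀ a l x r → a + # (node l x r) ≡ suc (a + # l) + # r
+-#-node a l x r = trans (cong (a +_) (#-node l x r))
  (trans (+-suc a _) (cong suc (sym (+-assoc a (# l) (# r)))))

-- Pigeonhole without counting: the root label cuts the interval, and each subtree has to fit into
-- its part.
labels-# : ∀ {a b} T → a ≤ b → SearchTree T → Labels a b T → a + # T ≤ b
labels-# {a} ∅ a≤b _ _ = ≤-trans (≤-reflexive (+-identityʳ a)) a≤b
labels-# (node l zero r) _ _ lab with All.++⁻ʳ (inorder l) lab
... | (() , _) ∷ _
labels-# {a} {b} (node l (suc y) r) _ st@(_ , _ , st-l , st-r) lab
  with lab-l , (a≤y , y<b) , lab-r ← labels-node⁻ l y r st lab = begin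
    a + # (node l (suc y) r)   ≡⟨ +-#-node a l (suc y) r ⟩
    suc (a + # l + # r)        ≤⟨ s≤s (+-monoˡ-≤ (# r) (labels-# l a≤y st-l lab-l)) ⟩
    suc (y + # r)              ≤⟨ labels-# r y<b st-r lab-r ⟩
    b                          ∎
  where open ≤-Reasoning

relabel-canonical : ∀ {a} T → SearchTree T → Labels a (a + # T) T → T ≡ relabel a T
relabel-canonical ∅ _ _ = refl
relabel-canonical (node l zero r) _ lab with All.++⁻ʳ (inorder l) lab
... | (() , _) ∷ _
relabel-canonical {a} (node l (suc y) r) st@(_ , _ , st-l , st-r) lab
  with lab-l , (a≤y , y<b) , lab-r ← labels-node⁻ l y r st lab
  -- The interval is exactly full: the left subtree pushes the root label up to at least a + `# l` +
  -- 1, the right one pushes it down to at most that.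
  with refl ← ≤-antisym (labels-# l a≤y st-l lab-l)
                (s≤s⁻¹ (+-cancelʳ-≤ (# r) (suc y) (suc (a + # l))
                  (≤-trans (labels-# r y<b st-r lab-r) (≤-reflexive (+-#-node a l (suc y) r)))))
  = cong₂ (λ u v → node u (suc (a + # l)) v)
      (relabel-canonical l st-l lab-l)
      (relabel-canonical r st-r (subst (λ b → Labels (suc (a + # l)) b r) (+-#-node a l _ r) lab-r))

#-relabel : ∀ a T → # relabel a T ≡ # T
#-relabel a ∅            = refl
#-relabel a (node l x r) = trans (#-node (relabel a l) _ (relabel _ r))
  (trans (cong suc (cong₂ _+_ (#-relabel a l) (#-relabel _ r))) (sym (#-node l x r)))

relabel-labels : ∀ a T → Labels a (a + # T) (relabel a T)
relabel-labels a ∅ = []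
relabel-labels a (node l x r)
  rewrite +-#-node a l x r =
  All.++⁺ (labels-widen (relabel a l) ≤-refl (m≤n⇒m≤1+n (m≤m+n _ _)) (relabel-labels a l))
    ((s≤s (m≤m+n a _) , s≤s (m≤m+n _ _)) ∷
     labels-widen (relabel _ r) (m≤n⇒m≤1+n (m≤m+n a _)) ≤-refl (relabel-labels (suc (a + # l)) r))

relabel-searchTree : ∀ a T → SearchTree (relabel a T)
relabel-searchTree a ∅            = tt
relabel-searchTree a (node l _ r) =
  All.map (s≤s ∘ proj₂) (relabel-labels a l) ,
  All.map proj₁ (relabel-labels (suc (a + # l)) r) ,
  relabel-searchTree a l , relabel-searchTree _ r

shape-relabel : ∀ a T → shape (relabel a T) ≡ shape T
shape-relabel a ∅                                    = refl
shape-relabel a (node ∅ _ ∅)                         = refl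
shape-relabel a (node l@(node _ _ _) _ ∅)            = cong ll (shape-relabel a l)
shape-relabel a (node ∅ _ r@(node _ _ _))            = cong rr (shape-relabel _ r)
shape-relabel a (node l@(node _ _ _) _ r@(node _ _ _)) =
  cong₂ bin (shape-relabel a l) (shape-relabel _ r)

skeleton : Shape → Tree
skeleton leaf      = node ∅ 0 ∅
skeleton (ll s)    = node (skeleton s) 0 ∅
skeleton (rr s)    = node ∅ 0 (skeleton s)
skeleton (bin l r) = node (skeleton l) 0 (skeleton r)

skeleton-nonEmpty : ∀ s → NonEmpty (skeleton s)
skeleton-nonEmpty leaf      = nonEmpty
skeleton-nonEmpty (ll _)    = nonEmpty
skeleton-nonEmpty (rr _)    = nonEmpty
skeleton-nonEmpty (bin _ _) = nonEmpty

shape-ll : ∀ {l x} → NonEmpty l → shape (node l x ∅) ≡ ll (shape l)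
shape-ll nonEmpty = refl

shape-rr : ∀ {x r} → NonEmpty r → shape (node ∅ x r) ≡ rr (shape r)
shape-rr nonEmpty = refl

shape-bin : ∀ {l x r} → NonEmpty l → NonEmpty r → shape (node l x r) ≡ bin (shape l) (shape r)
shape-bin nonEmpty nonEmpty = refl

shape-skeleton : ∀ s → shape (skeleton s) ≡ s
shape-skeleton leaf      = refl
shape-skeleton (ll s)    = trans (shape-ll (skeleton-nonEmpty s)) (cong ll (shape-skeleton s))
shape-skeleton (rr s)    = trans (shape-rr (skeleton-nonEmpty s)) (cong rr (shape-skeleton s))
shape-skeleton (bin l r) = trans (shape-bin (skeleton-nonEmpty l) (skeleton-nonEmpty r))
  (cong₂ bin (shape-skeleton l) (shape-skeleton r))

#-skeleton : ∀ {T} → NonEmpty T → # skeleton (shape T) ≡ # T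
#-skeleton {T} ne = trans (#≡size (skeleton-nonEmpty (shape T)))
  (trans (cong size (shape-skeleton (shape T))) (sym (#≡size ne)))

relabel-node : ∀ {a} l x r l′ x′ r′ → # l ≡ # l′ → relabel a l ≡ relabel a l′ →
               (∀ b → relabel b r ≡ relabel b r′) → relabel a (node l x r) ≡ relabel a (node l′ x′ r′)
relabel-node _ _ _ _ _ _ #≡ l≡ r≡ rewrite #≡ = cong₂ (λ u v → node u _ v) l≡ (r≡ _)

-- The offset is universally quantified because the right subtree is numbered from an offset that
-- depends on the size of the left one.
relabel-skeleton : ∀ {T} → NonEmpty T → ∀ a → relabel a (skeleton (shape T)) ≡ relabel a T
relabel-skeleton {node ∅ _ ∅} _ a = refl
relabel-skeleton {node l@(node _ _ _) x ∅} _ a = relabel-node (skeleton (shape l)) 0 ∅ l x ∅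
  (#-skeleton {l} nonEmpty) (relabel-skeleton {l} nonEmpty a) λ _ → refl
relabel-skeleton {node ∅ x r@(node _ _ _)} _ a = relabel-node ∅ 0 (skeleton (shape r)) ∅ x r
  refl refl (relabel-skeleton {r} nonEmpty)
relabel-skeleton {node l@(node _ _ _) x r@(node _ _ _)} _ a =
  relabel-node (skeleton (shape l)) 0 (skeleton (shape r)) l x r
    (#-skeleton {l} nonEmpty) (relabel-skeleton {l} nonEmpty a) (relabel-skeleton {r} nonEmpty)

label : Shape → Tree
label s = relabel 0 (skeleton s)

shape-label : ∀ s → shape (label s) ≡ s
shape-label s = trans (shape-relabel 0 (skeleton s)) (shape-skeleton s)

label-𝒯 : ∀ s → 𝒯 (size s) (label s)
label-𝒯 s = relabel-searchTree 0 (skeleton s) , trans (#-relabel 0 (skeleton s)) #≡ ,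
  subst (λ n → Labels 0 n (label s)) #≡ (relabel-labels 0 (skeleton s))
  where
  #≡ : # skeleton s ≡ size s
  #≡ = trans (#≡size (skeleton-nonEmpty s)) (cong size (shape-skeleton s))

label-shape : ∀ {n T} → NonEmpty T → 𝒯 n T → label (shape T) ≡ T
label-shape {T = T} ne (st , refl , lab) =
  trans (relabel-skeleton ne 0) (sym (relabel-canonical T st lab))

-- Shapes and Motzkin words

word : Shape → List Step
word leaf      = []
word (ll s)    = Fᴸ ∷ word s
word (rr s)    = Fᴿ ∷ word s
word (bin l r) = U ∷ word r ++ D ∷ word l

toMotzkin≡word : ∀ T → toMotzkin T ≡ word (shape T)
toMotzkin≡word ∅                         = refl
toMotzkin≡word (node ∅ _ ∅)              = refl
toMotzkin≡word (node l@(node _ _ _) _ ∅) = cong (Fᴸ ∷_) (toMotzkin≡word l)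
toMotzkin≡word (node ∅ _ r@(node _ _ _)) = cong (Fᴿ ∷_) (toMotzkin≡word r)
toMotzkin≡word (node l@(node _ _ _) _ r@(node _ _ _)) =
  cong₂ (λ u v → U ∷ u ++ D ∷ v) (toMotzkin≡word r) (toMotzkin≡word l)

word-length : ∀ s → suc (length (word s)) ≡ size s
word-length leaf      = refl
word-length (ll s)    = cong suc (word-length s)
word-length (rr s)    = cong suc (word-length s)
word-length (bin l r) = cong suc (begin
  suc (length (word r ++ D ∷ word l))           ≡⟨ cong suc (length-++ (word r)) ⟩
  suc (length (word r)) + suc (length (word l)) ≡⟨ cong₂ _+_ (word-length r) (word-length l) ⟩
  size r + size l                               ≡⟨ +-comm (size r) (size l) ⟩
  size l + size r                               ∎)
  where open ≡-Reasoning

word-bin : ∀ l r u → word (bin l r) ++ u ≡ U ∷ word r ++ D ∷ word l ++ u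
word-bin l r u = cong (U ∷_) (++-assoc (word r) (D ∷ word l) u)

-- What can follow word s inside the word of a larger shape.
data Stop : List Step → Set where
  end  : Stop []
  down : ∀ {w} → Stop (D ∷ w)

-- Unique readability: no `word` starts with `D`, so the first letter tells the constructor, and
-- `leaf` is recognised by `D` or the end. After `U`, the word of the right subtree is itself
-- followed by `D`, so the hypothesis recurs.
word-cancel : ∀ s t {u v} → Stop u → Stop v → word s ++ u ≡ word t ++ v → s ≡ t × u ≡ v
word-cancel leaf      leaf      _  _  eq = refl , eq
word-cancel leaf      (ll _)    end  _ ()
word-cancel leaf      (ll _)    down _ ()
word-cancel leaf      (rr _)    end  _ ()
word-cancel leaf      (rr _)    down _ ()
word-cancel leaf      (bin _ _) end  _ ()
word-cancel leaf      (bin _ _) down _ ()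
word-cancel (ll _)    leaf      _ end  ()
word-cancel (ll _)    leaf      _ down ()
word-cancel (rr _)    leaf      _ end  ()
word-cancel (rr _)    leaf      _ down ()
word-cancel (bin _ _) leaf      _ end  ()
word-cancel (bin _ _) leaf      _ down ()
word-cancel (ll s)    (ll t)    su sv eq with word-cancel s t su sv (∷-injectiveʳ eq)
... | refl , u≡v = refl , u≡v
word-cancel (rr s)    (rr t)    su sv eq with word-cancel s t su sv (∷-injectiveʳ eq)
... | refl , u≡v = refl , u≡v
word-cancel (bin l r) (bin l′ r′) {u} {v} su sv eq
  with refl , eq′ ← word-cancel r r′ down down
         (∷-injectiveʳ (trans (sym (word-bin l r u)) (trans eq (word-bin l′ r′ v))))
  with refl , u≡v ← word-cancel l l′ su sv (∷-injectiveʳ eq′) = refl , u≡v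

word-injective : ∀ {s t} → word s ≡ word t → s ≡ t
word-injective {s} {t} eq = proj₁ (word-cancel s t end end (cong (_++ []) eq))

-- Paths from height h down to 0. With a natural number as index, staying above the axis is built
-- in, and arbitrary h makes the condition pass to suffixes.
data Path : ℕ → List Step → Set where
  end : Path 0 []
  up  : ∀ {h w} → Path (suc h) w → Path h (U ∷ w)
  dn  : ∀ {h w} → Path h w → Path (suc h) (D ∷ w)
  fl  : ∀ {h w} → Path h w → Path h (Fᴸ ∷ w)
  fr  : ∀ {h w} → Path h w → Path h (Fᴿ ∷ w)

up-height : ∀ h w → ℤ.+ suc h ℤ.+ height w ≡ ℤ.+ h ℤ.+ height (U ∷ w)
up-height h w = trans (cong (λ k → ℤ.+ k ℤ.+ height w) (sym (+-comm h 1)))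
  (ℤ.+-assoc (ℤ.+ h) ℤ.1ℤ (height w))

down-height : ∀ h w → ℤ.+ h ℤ.+ height w ≡ ℤ.+ suc h ℤ.+ height (D ∷ w)
down-height h w = ℤ.+-assoc (ℤ.+ suc h) ℤ.-1ℤ (height w)

flat-height : ∀ h w → ℤ.+ h ℤ.+ height w ≡ ℤ.+ h ℤ.+ (0ℤ ℤ.+ height w)
flat-height h w = cong (λ j → ℤ.+ h ℤ.+ j) (sym (ℤ.+-identityˡ (height w)))

path-height : ∀ {h w} → Path h w → ℤ.+ h ℤ.+ height w ≡ 0ℤ
path-height end                    = refl
path-height {h}     {_ ∷ w} (up p) = trans (sym (up-height h w))   (path-height p)
path-height {suc h} {_ ∷ w} (dn p) = trans (sym (down-height h w)) (path-height p)
path-height {h}     {_ ∷ w} (fl p) = trans (sym (flat-height h w)) (path-height p)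
path-height {h}     {_ ∷ w} (fr p) = trans (sym (flat-height h w)) (path-height p)

path-nonNegative : ∀ {h} u {v} → Path h (u ++ v) → 0ℤ ℤ.≤ ℤ.+ h ℤ.+ height u
path-nonNegative         []      _      = ℤ.+≤+ z≤n
path-nonNegative {h}     (_ ∷ u) (up p) = subst (0ℤ ℤ.≤_) (up-height h u)   (path-nonNegative u p)
path-nonNegative {suc h} (_ ∷ u) (dn p) = subst (0ℤ ℤ.≤_) (down-height h u) (path-nonNegative u p)
path-nonNegative {h}     (_ ∷ u) (fl p) = subst (0ℤ ℤ.≤_) (flat-height h u) (path-nonNegative u p)
path-nonNegative {h}     (_ ∷ u) (fr p) = subst (0ℤ ℤ.≤_) (flat-height h u) (path-nonNegative u p)

toPath : ∀ h w → ℤ.+ h ℤ.+ height w ≡ 0ℤ →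
         (∀ u v → w ≡ u ++ v → 0ℤ ℤ.≤ ℤ.+ h ℤ.+ height u) → Path h w
toPath zero    []       _  _  = end
toPath (suc h) []       () _
toPath h       (U ∷ w)  eq nn = up (toPath (suc h) w (trans (up-height h w) eq)
  λ u v e → subst (0ℤ ℤ.≤_) (sym (up-height h u)) (nn (U ∷ u) v (cong (U ∷_) e)))
-- The one-letter prefix `D` would already have height -1.
toPath zero    (D ∷ w)  eq nn with () ← nn (D ∷ []) w refl
toPath (suc h) (D ∷ w)  eq nn = dn (toPath h w (trans (down-height h w) eq)
  λ u v e → subst (0ℤ ℤ.≤_) (sym (down-height h u)) (nn (D ∷ u) v (cong (D ∷_) e)))
toPath h       (Fᴸ ∷ w) eq nn = fl (toPath h w (trans (flat-height h w) eq)
  λ u v e → subst (0ℤ ℤ.≤_) (sym (flat-height h u)) (nn (Fᴸ ∷ u) v (cong (Fᴸ ∷_) e)))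
toPath h       (Fᴿ ∷ w) eq nn = fr (toPath h w (trans (flat-height h w) eq)
  λ u v e → subst (0ℤ ℤ.≤_) (sym (flat-height h u)) (nn (Fᴿ ∷ u) v (cong (Fᴿ ∷_) e)))

word-path : ∀ {h u} s → Path h u → Path h (word s ++ u)
word-path leaf      p = p
word-path (ll s)    p = fl (word-path s p)
word-path (rr s)    p = fr (word-path s p)
word-path {u = u} (bin l r) p = subst (Path _) (sym (word-bin l r u)) (up (word-path r (dn (word-path l p))))

word-isMotzkin : ∀ s → IsMotzkin (word s)
word-isMotzkin s = trans (sym (ℤ.+-identityˡ _)) (path-height p) ,
  λ u v eq → subst (0ℤ ℤ.≤_) (ℤ.+-identityˡ _) (path-nonNegative u (subst (Path 0) eq p))
  where
  p : Path 0 (word s)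
  p = subst (Path 0) (++-identityʳ (word s)) (word-path s end)

descents : ∀ {h} → Vec Shape h → List Step
descents []       = []
descents (s ∷ ss) = D ∷ word s ++ descents ss

-- The path is cut at its first visits to the heights h − 1, …, 0.
parse : ∀ {h w} → Path h w → Σ[ s ∈ Shape ] Σ[ ss ∈ Vec Shape h ] word s ++ descents ss ≡ w
parse end = leaf , [] , refl
parse (up p) with parse p
-- The first `D` among the descents closes the `U` just read: the word before it is the right
-- subtree and the word after it the left one.
... | r , l ∷ ss , eq = bin l r , ss , trans (word-bin l r (descents ss)) (cong (U ∷_) eq)
parse (dn p) with parse p
... | s , ss , eq = leaf , s ∷ ss , cong (D ∷_) eq
parse (fl p) with parse p
... | s , ss , eq = ll s , ss , cong (Fᴸ ∷_) eq
parse (fr p) with parse p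
... | s , ss , eq = rr s , ss , cong (Fᴿ ∷_) eq

word-surjective : ∀ {w} → IsMotzkin w → Σ[ s ∈ Shape ] word s ≡ w
word-surjective {w} (h≡0 , nn)
  with parse (toPath 0 w (trans (ℤ.+-identityˡ _) h≡0)
         λ u v e → subst (0ℤ ℤ.≤_) (sym (ℤ.+-identityˡ _)) (nn u v e))
... | s , [] , eq = s , trans (sym (++-identityʳ (word s))) eq

-- Containment of a pattern as an occurrence of a local configuration

⊴-trans : ∀ {R S T} → R ⊴ S → S ⊴ T → R ⊴ T
⊴-trans p here      = p
⊴-trans p (left q)  = left (⊴-trans p q)
⊴-trans p (right q) = right (⊴-trans p q)

⊴-∈ : ∀ {S T i} → S ⊴ T → i ∈ᵗ S → i ∈ᵗ T
⊴-∈ here i∈ = i∈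
⊴-∈ (left p) i∈ = ∈-++⁺ˡ (⊴-∈ p i∈)
⊴-∈ (right {l = l} p) i∈ = ∈-++⁺ʳ (inorder l) (there (⊴-∈ p i∈))

⊴-searchTree : ∀ {S T} → S ⊴ T → SearchTree T → SearchTree S
⊴-searchTree here      st               = st
⊴-searchTree (left p)  (_ , _ , st , _) = ⊴-searchTree p st
⊴-searchTree (right p) (_ , _ , _ , st) = ⊴-searchTree p st

root∈ : ∀ {l x r T} → node l x r ⊴ T → x ∈ᵗ T
root∈ {l} p = ⊴-∈ p (∈-++⁺ʳ (inorder l) (here refl))

-- A label occurs at one vertex only, since labels to the left of a vertex are smaller and those to
-- the right larger. This lets the separate edge conditions of a containment, each with its own
-- hidden subtrees, be glued at a common label.
⊴-unique : ∀ {l x r l′ r′ T} → SearchTree T → node l x r ⊴ T → node l′ x r′ ⊴ T → l ≡ l′ × r ≡ r′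
⊴-unique _                    here      here      = refl , refl
⊴-unique (l< , _)             here      (left q)  = contradiction (All.lookup l< (root∈ q)) (<-irrefl refl)
⊴-unique (_ , <r , _)         here      (right q) = contradiction (All.lookup <r (root∈ q)) (<-irrefl refl)
⊴-unique (l< , _)             (left p)  here      = contradiction (All.lookup l< (root∈ p)) (<-irrefl refl)
⊴-unique (_ , _ , st , _)     (left p)  (left q)  = ⊴-unique st p q
⊴-unique (l< , <r , _)        (left p)  (right q) = contradiction (All.lookup <r (root∈ q)) (<-asym (All.lookup l< (root∈ p)))
⊴-unique (_ , <r , _)         (right p) here      = contradiction (All.lookup <r (root∈ p)) (<-irrefl refl)
⊴-unique (l< , <r , _)        (right p) (left q)  = contradiction (All.lookup <r (root∈ p)) (<-asym (All.lookup l< (root∈ q)))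
⊴-unique (_ , _ , _ , st)     (right p) (right q) = ⊴-unique st p q

∈⇒nonEmpty : ∀ {i T} → i ∈ᵗ T → NonEmpty T
∈⇒nonEmpty {T = node _ _ _} _ = nonEmpty

leftSubtree-nonEmpty : ∀ {T l x r j} → SearchTree T → node l x r ⊴ T → InLeftSubtree T j x → NonEmpty l
leftSubtree-nonEmpty st p (_ , _ , q , j∈) with refl , _ ← ⊴-unique st p q = ∈⇒nonEmpty j∈

rightSubtree-nonEmpty : ∀ {T l x r j} → SearchTree T → node l x r ⊴ T → InRightSubtree T j x → NonEmpty r
rightSubtree-nonEmpty st p (_ , _ , q , j∈) with _ , refl ← ⊴-unique st p q = ∈⇒nonEmpty j∈

leftChild⇒inLeftSubtree : ∀ {T j i} → IsLeftChild T j i → InLeftSubtree T j i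
leftChild⇒inLeftSubtree {j = j} (l , r , _ , p) = _ , _ , p , root∈ {l} {j} {r} here

rightChild⇒inRightSubtree : ∀ {T j i} → IsRightChild T j i → InRightSubtree T j i
rightChild⇒inRightSubtree {j = j} (_ , l , r , p) = _ , _ , p , root∈ {l} {j} {r} here

module _ {k T} {π : Pattern k} (c : Contains T π) where
  open Pattern π
  open Contains c

  -- A child is also a descendant on that side, so this much survives whatever `e i` is.
  left-edge : ∀ {i p} → IsLeftChild tree i p → InLeftSubtree T (f i) (f p)
  left-edge {i} {p} ch with e i in eq
  ... | 0F = left-0 i p ch eq
  ... | 1F = leftChild⇒inLeftSubtree (left-1 i p ch eq)

  right-edge : ∀ {i p} → IsRightChild tree i p → InRightSubtree T (f i) (f p)
  right-edge {i} {p} ch with e i in eq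
  ... | 0F = right-0 i p ch eq
  ... | 1F = rightChild⇒inRightSubtree (right-1 i p ch eq)

-- The strongest form of occurrence: the pattern sits at the root of S and each of its edges is an
-- edge of S.
data Embeds (f : ℕ → ℕ) : Tree → Tree → Set where
  ∅    : ∀ {S} → Embeds f ∅ S
  node : ∀ {l x r l′ r′} → Embeds f l l′ → Embeds f r r′ → Embeds f (node l x r) (node l′ (f x) r′)

module _ {f : ℕ → ℕ} where

  embeds-∈ : ∀ {P S i} → Embeds f P S → i ∈ᵗ P → f i ∈ᵗ S
  embeds-∈ {node l x r} (node {l′ = l′} el er) i∈ with ∈-++⁻ (inorder l) i∈
  ... | inj₁ i∈l         = ∈-++⁺ˡ (embeds-∈ el i∈l)
  ... | inj₂ (here refl) = ∈-++⁺ʳ (inorder l′) (here refl)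
  ... | inj₂ (there i∈r) = ∈-++⁺ʳ (inorder l′) (there (embeds-∈ er i∈r))

  embeds-injective : ∀ {P S} → SearchTree S → Embeds f P S → InjectiveOn f (_∈ᵗ P)
  embeds-injective {node l x r} (l< , <r , st-l , st-r) (node el er) i j i∈ j∈ eq
    with ∈-++⁻ (inorder l) i∈ | ∈-++⁻ (inorder l) j∈
  ... | inj₁ i∈l         | inj₁ j∈l         = embeds-injective st-l el i j i∈l j∈l eq
  ... | inj₁ i∈l         | inj₂ (here refl) = contradiction eq (<⇒≢ (All.lookup l< (embeds-∈ el i∈l)))
  ... | inj₁ i∈l         | inj₂ (there j∈r) = contradiction eq
    (<⇒≢ (<-trans (All.lookup l< (embeds-∈ el i∈l)) (All.lookup <r (embeds-∈ er j∈r))))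
  ... | inj₂ (here refl) | inj₁ j∈l         = contradiction (sym eq) (<⇒≢ (All.lookup l< (embeds-∈ el j∈l)))
  ... | inj₂ (here refl) | inj₂ (here refl) = refl
  ... | inj₂ (here refl) | inj₂ (there j∈r) = contradiction eq (<⇒≢ (All.lookup <r (embeds-∈ er j∈r)))
  ... | inj₂ (there i∈r) | inj₁ j∈l         = contradiction (sym eq)
    (<⇒≢ (<-trans (All.lookup l< (embeds-∈ el j∈l)) (All.lookup <r (embeds-∈ er i∈r))))
  ... | inj₂ (there i∈r) | inj₂ (here refl) = contradiction (sym eq) (<⇒≢ (All.lookup <r (embeds-∈ er i∈r)))
  ... | inj₂ (there i∈r) | inj₂ (there j∈r) = embeds-injective st-r er i j i∈r j∈r eq

  embeds-⊴ : ∀ {P Q S} → Embeds f P S → Q ⊴ P → ∃[ R ] R ⊴ S × Embeds f Q R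
  embeds-⊴ e            here      = _ , here , e
  embeds-⊴ (node el er) (left p)  with R , q , e ← embeds-⊴ el p = R , left q , e
  embeds-⊴ (node el er) (right p) with R , q , e ← embeds-⊴ er p = R , right q , e

  embeds-leftChild : ∀ {P S i p} → Embeds f P S → IsLeftChild P i p → IsLeftChild S (f i) (f p)
  embeds-leftChild e (_ , _ , _ , ch) with embeds-⊴ e ch
  ... | _ , q , node (node _ _) _ = _ , _ , _ , q

  embeds-rightChild : ∀ {P S i p} → Embeds f P S → IsRightChild P i p → IsRightChild S (f i) (f p)
  embeds-rightChild e (_ , _ , _ , ch) with embeds-⊴ e ch
  ... | _ , q , node _ (node _ _) = _ , _ , _ , q

-- Actual edges satisfy both kinds of edge condition, so this holds for every `e`.
embeds⇒contains : ∀ {k f S T} {π : Pattern k} → SearchTree T → S ⊴ T →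
                  Embeds f (Pattern.tree π) S → Contains T π
embeds⇒contains {f = f} {T = T} {π} st S⊴T em = record
  { f           = f
  ; f-maps      = λ i i∈ → ⊴-∈ S⊴T (embeds-∈ em i∈)
  ; f-injective = embeds-injective (⊴-searchTree S⊴T st) em
  ; left-1      = λ i p ch _ → left-child ch
  ; right-1     = λ i p ch _ → right-child ch
  ; left-0      = λ i p ch _ → leftChild⇒inLeftSubtree (left-child ch)
  ; right-0     = λ i p ch _ → rightChild⇒inRightSubtree (right-child ch)
  }
  where
  open Pattern π using (tree)
  left-child : ∀ {i p} → IsLeftChild tree i p → IsLeftChild T (f i) (f p)
  left-child ch with _ , _ , _ , q ← embeds-leftChild em ch = _ , _ , _ , ⊴-trans q S⊴T
  right-child : ∀ {i p} → IsRightChild tree i p → IsRightChild T (f i) (f p)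
  right-child ch with _ , _ , _ , q ← embeds-rightChild em ch = _ , _ , _ , ⊴-trans q S⊴T

Occurs : (Shape → Set) → Tree → Set
Occurs Bad T = ∃[ S ] S ⊴ T × Bad (shape S)

-- Two patterns that capture the same `Bad` have the same avoiders; this is how entries of `e`
-- become free.
Captures : ∀ {k} → Pattern k → (Shape → Set) → Set
Captures π Bad = ∀ {T} → SearchTree T → Contains T π ⇔ Occurs Bad T

-- Turns a list of target labels into a label map. Pattern labels start at 1, so the lists below
-- carry a filler 0 in front.
nth : List ℕ → ℕ → ℕ
nth []       _       = 0
nth (x ∷ _)  zero    = x
nth (_ ∷ xs) (suc i) = nth xs i

data Bad₁ : Shape → Set where
  bad : ∀ {l m r} → Bad₁ (bin l (bin m r))

data Bad₂ : Shape → Set where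
  bad : ∀ {l m r} → Bad₂ (bin (bin l m) r)

-- The part of 13254 below its root, rooted at the vertex 3. Two constructors, because the vertex 5
-- may or may not have a right child in the host; `Bad₃` likewise splits on a left child of the
-- vertex 1.
data Bent : Shape → Set where
  bent-ll  : ∀ {l s} → Bent (bin l (ll s))
  bent-bin : ∀ {l m r} → Bent (bin l (bin m r))

data Bad₃ : Shape → Set where
  bad-rr  : ∀ {r} → Bent r → Bad₃ (rr r)
  bad-bin : ∀ {l r} → Bent r → Bad₃ (bin l r)

-- Only the edge from 2 to 4 joins two internal vertices of the pattern, and it is required to be a
-- true edge. The other edges end in leaves: they say that a subtree is nonempty, and its root can
-- then serve as the leaf.
captures₁ : ∀ x y z → Captures ⟨21435, x ∷ 1F ∷ y ∷ z ∷ [] ⟩ Bad₁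
captures₁ x y z {T} st = mk⇔ to from
  where
  to : Contains T _ → Occurs Bad₁ T
  to c with Contains.right-1 c 4 2 (_ , _ , _ , here) refl
  ... | s , l , r , p
    with leftSubtree-nonEmpty st p (left-edge c {1} {2} (_ , _ , _ , here))
       | leftSubtree-nonEmpty st (⊴-trans (right here) p) (left-edge c {3} {4} (_ , _ , _ , right here))
       | rightSubtree-nonEmpty st (⊴-trans (right here) p) (right-edge c {5} {4} (_ , _ , _ , right here))
  ... | nonEmpty | nonEmpty | nonEmpty = _ , p , bad

  root : ∀ S → Bad₁ (shape S) → ∃[ f ] Embeds f P21435 S
  root (node (node _ v₁ _) v₂ (node (node _ v₃ _) v₄ (node _ v₅ _))) _ =
    nth (0 ∷ v₁ ∷ v₂ ∷ v₃ ∷ v₄ ∷ v₅ ∷ []) , node (node ∅ ∅) (node (node ∅ ∅) (node ∅ ∅))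
  root (node (node _ _ _) _ (node ∅ _ ∅)) ()
  root (node (node _ _ _) _ (node ∅ _ (node _ _ _))) ()
  root (node (node _ _ _) _ (node (node _ _ _) _ ∅)) ()
  root (node ∅ _ ∅) ()
  root (node ∅ _ (node _ _ _)) ()
  root (node (node _ _ _) _ ∅) ()

  from : Occurs Bad₁ T → Contains T _
  from (S , p , b) = embeds⇒contains st p (proj₂ (root S b))

captures₂ : ∀ x y z → Captures ⟨42135, 1F ∷ x ∷ y ∷ z ∷ [] ⟩ Bad₂
captures₂ x y z {T} st = mk⇔ to from
  where
  to : Contains T _ → Occurs Bad₂ T
  to c with Contains.left-1 c 2 4 (_ , _ , _ , here) refl
  ... | l , r , s , p
    with leftSubtree-nonEmpty st (⊴-trans (left here) p) (left-edge c {1} {2} (_ , _ , _ , left here))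
       | rightSubtree-nonEmpty st (⊴-trans (left here) p) (right-edge c {3} {2} (_ , _ , _ , left here))
       | rightSubtree-nonEmpty st p (right-edge c {5} {4} (_ , _ , _ , here))
  ... | nonEmpty | nonEmpty | nonEmpty = _ , p , bad

  root : ∀ S → Bad₂ (shape S) → ∃[ f ] Embeds f P42135 S
  root (node (node (node _ v₁ _) v₂ (node _ v₃ _)) v₄ (node _ v₅ _)) _ =
    nth (0 ∷ v₁ ∷ v₂ ∷ v₃ ∷ v₄ ∷ v₅ ∷ []) , node (node (node ∅ ∅) (node ∅ ∅)) (node ∅ ∅)
  root (node (node ∅ _ ∅) _ (node _ _ _)) ()
  root (node (node ∅ _ (node _ _ _)) _ (node _ _ _)) ()
  root (node (node (node _ _ _) _ ∅) _ (node _ _ _)) ()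
  root (node ∅ _ ∅) ()
  root (node ∅ _ (node _ _ _)) ()
  root (node (node _ _ _) _ ∅) ()

  from : Occurs Bad₂ T → Contains T _
  from (S , p , b) = embeds⇒contains st p (proj₂ (root S b))

captures₃ : ∀ x y → Captures ⟨13254, 1F ∷ x ∷ 1F ∷ y ∷ [] ⟩ Bad₃
captures₃ x y {T} st = mk⇔ to from
  where
  bent : ∀ a {l r} → NonEmpty a → NonEmpty l → ∀ {u v} → Bent (shape (node a u (node l v r)))
  bent (node _ _ _) {r = ∅}          nonEmpty nonEmpty = bent-ll
  bent (node _ _ _) {r = node _ _ _} nonEmpty nonEmpty = bent-bin

  bad-node : ∀ s {v r} → NonEmpty r → Bent (shape r) → Bad₃ (shape (node s v r))
  bad-node ∅            nonEmpty b = bad-rr b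
  bad-node (node _ _ _) nonEmpty b = bad-bin b

  to : Contains T _ → Occurs Bad₃ T
  to c with Contains.right-1 c 3 1 (_ , _ , _ , here) refl
          | Contains.right-1 c 5 3 (_ , _ , _ , right here) refl
  ... | s , m , r , p | _ , l , _ , q
    -- Two true edges meet at the image of 3; identifying both copies of its subtree produces the
    -- right chain through the images of 1, 3, 5.
    with refl , refl ← ⊴-unique st (⊴-trans (right here) p) q
    = _ , p , bad-node s nonEmpty (bent m
        (leftSubtree-nonEmpty st q (left-edge c {2} {3} (_ , _ , _ , right here)))
        (leftSubtree-nonEmpty st (⊴-trans (right here) q) (left-edge c {4} {5} (_ , _ , _ , right (right here)))))

  -- The label map can only be fixed once the image of 1 is known too, so it enters here through its
  -- values at 2, ..., 5.
  root-bent : ∀ S → Bent (shape S) → ∃[ u ] ∃[ v ] ∃[ w ] ∃[ x ]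
              ∀ {f} → f 2 ≡ u → f 3 ≡ v → f 4 ≡ w → f 5 ≡ x →
              Embeds f (node (node ∅ 2 ∅) 3 (node (node ∅ 4 ∅) 5 ∅)) S
  root-bent (node (node _ u _) v (node (node _ w _) x _)) _ = u , v , w , x ,
    λ { refl refl refl refl → node (node ∅ ∅) (node (node ∅ ∅) ∅) }
  root-bent (node (node _ _ _) _ (node ∅ _ ∅)) ()
  root-bent (node (node _ _ _) _ (node ∅ _ (node _ _ _))) ()
  root-bent (node ∅ _ ∅) ()
  root-bent (node ∅ _ (node _ _ _)) ()
  root-bent (node (node _ _ _) _ ∅) ()

  from : Occurs Bad₃ T → Contains T _
  from (S , p , b) = embeds⇒contains st p (proj₂ (root S b))
    where
    root : ∀ S → Bad₃ (shape S) → ∃[ f ] Embeds f P13254 S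
    root (node ∅ t r@(node _ _ _)) (bad-rr b) with root-bent r b
    ... | u , v , w , x , em =
      nth (0 ∷ t ∷ u ∷ v ∷ w ∷ x ∷ []) , node ∅ (em refl refl refl refl)
    root (node (node _ _ _) t r@(node _ _ _)) (bad-bin b) with root-bent r b
    ... | u , v , w , x , em =
      nth (0 ∷ t ∷ u ∷ v ∷ w ∷ x ∷ []) , node ∅ (em refl refl refl refl)

-- Avoidance in trees and in words

Good : (Shape → Set) → Shape → Set
Good Bad s@leaf      = ¬ Bad s
Good Bad s@(ll t)    = ¬ Bad s × Good Bad t
Good Bad s@(rr t)    = ¬ Bad s × Good Bad t
Good Bad s@(bin l r) = ¬ Bad s × Good Bad l × Good Bad r

good-root : ∀ {Bad} s → Good Bad s → ¬ Bad s
good-root leaf      g       = g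
good-root (ll _)    (g , _) = g
good-root (rr _)    (g , _) = g
good-root (bin _ _) (g , _) = g

-- The relation `⊴` also admits the empty tree, whose junk shape is `leaf`; the hypothesis keeps it
-- from counting as an occurrence.
module _ {Bad : Shape → Set} (¬bad-leaf : ¬ Bad leaf) where

  good-left : ∀ l x r → Good Bad (shape (node l x r)) → Good Bad (shape l)
  good-left ∅            _ _            _           = ¬bad-leaf
  good-left (node _ _ _) _ ∅            (_ , g)     = g
  good-left (node _ _ _) _ (node _ _ _) (_ , g , _) = g

  good-right : ∀ l x r → Good Bad (shape (node l x r)) → Good Bad (shape r)
  good-right _            _ ∅            _           = ¬bad-leaf
  good-right ∅            _ (node _ _ _) (_ , g)     = g
  good-right (node _ _ _) _ (node _ _ _) (_ , _ , g) = g

  good⇒¬occurs : ∀ {T} → Good Bad (shape T) → ¬ Occurs Bad T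
  good⇒¬occurs {T} g (_ , here , b) = good-root (shape T) g b
  good⇒¬occurs {node l x r} g (S , left p , b)  = good⇒¬occurs (good-left l x r g) (S , p , b)
  good⇒¬occurs {node l x r} g (S , right p , b) = good⇒¬occurs (good-right l x r g) (S , p , b)

  ¬occurs⇒good : ∀ T → ¬ Occurs Bad T → Good Bad (shape T)
  ¬occurs⇒good ∅ ¬o = ¬bad-leaf
  ¬occurs⇒good (node ∅ _ ∅) ¬o = ¬bad-leaf
  ¬occurs⇒good (node l@(node _ _ _) _ ∅) ¬o = (λ b → ¬o (_ , here , b)) ,
    ¬occurs⇒good l λ (S , p , b) → ¬o (S , left p , b)
  ¬occurs⇒good (node ∅ _ r@(node _ _ _)) ¬o = (λ b → ¬o (_ , here , b)) ,
    ¬occurs⇒good r λ (S , p , b) → ¬o (S , right p , b)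
  ¬occurs⇒good (node l@(node _ _ _) _ r@(node _ _ _)) ¬o = (λ b → ¬o (_ , here , b)) ,
    ¬occurs⇒good l (λ (S , p , b) → ¬o (S , left p , b)) ,
    ¬occurs⇒good r λ (S , p , b) → ¬o (S , right p , b)

Hit : List (List Step) → List Step → Set
Hit Z w = ∃[ z ] z ∈ Z × Prefix _≡_ z w

Avoids : List (List Step) → List Step → Set
Avoids Z w = ∀ z → z ∈ Z → ¬ Infix _≡_ z w

avoids-∷⁺ : ∀ {Z c w} → ¬ Hit Z (c ∷ w) → Avoids Z w → Avoids Z (c ∷ w)
avoids-∷⁺ ¬h av z z∈ (here p)  = ¬h (z , z∈ , p)
avoids-∷⁺ ¬h av z z∈ (there i) = av z z∈ i

avoids-hit : ∀ {Z w} → Avoids Z w → ¬ Hit Z w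
avoids-hit av (z , z∈ , p) = av z z∈ (here p)

avoids-tail : ∀ {Z c w} → Avoids Z (c ∷ w) → Avoids Z w
avoids-tail av z z∈ i = av z z∈ (there i)

-- Each occurrence of a factor is charged to the vertex that wrote its first letter. A vertex with
-- two children writes both a `U` and a `D`, hence the disjunction in `hit-bin`.
record Detects (Z : List (List Step)) (Bad : Shape → Set) : Set where
  field
    ¬hit-[]   : ¬ Hit Z []
    ¬bad-leaf : ¬ Bad leaf
    hit-ll    : ∀ s {u} → Stop u → Hit Z (Fᴸ ∷ word s ++ u) ⇔ Bad (ll s)
    hit-rr    : ∀ s {u} → Stop u → Hit Z (Fᴿ ∷ word s ++ u) ⇔ Bad (rr s)
    hit-bin   : ∀ l r {u} → Stop u →
                (Hit Z (U ∷ word r ++ D ∷ word l ++ u) ⊎ Hit Z (D ∷ word l ++ u)) ⇔ Bad (bin l r)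

  open Equivalence

  good⇒avoids : ∀ s {u} → Stop u → Good Bad s → Avoids Z u → Avoids Z (word s ++ u)
  good⇒avoids leaf   su _        av = av
  good⇒avoids (ll s) su (¬b , g) av = avoids-∷⁺ (¬b ∘ to (hit-ll s su)) (good⇒avoids s su g av)
  good⇒avoids (rr s) su (¬b , g) av = avoids-∷⁺ (¬b ∘ to (hit-rr s su)) (good⇒avoids s su g av)
  good⇒avoids (bin l r) {u} su (¬b , gl , gr) av = subst (Avoids Z) (sym (word-bin l r u))
    (avoids-∷⁺ (¬b ∘ to (hit-bin l r su) ∘ inj₁) (good⇒avoids r down gr
      (avoids-∷⁺ (¬b ∘ to (hit-bin l r su) ∘ inj₂) (good⇒avoids l su gl av))))

  avoids⇒good : ∀ s {u} → Stop u → Avoids Z (word s ++ u) → Good Bad s × Avoids Z u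
  avoids⇒good leaf su av = ¬bad-leaf , av
  avoids⇒good (ll s) su av with g , av-u ← avoids⇒good s su (avoids-tail av) =
    (avoids-hit av ∘ from (hit-ll s su) , g) , av-u
  avoids⇒good (rr s) su av with g , av-u ← avoids⇒good s su (avoids-tail av) =
    (avoids-hit av ∘ from (hit-rr s su) , g) , av-u
  avoids⇒good (bin l r) {u} su av₀
    with av ← subst (Avoids Z) (word-bin l r u) av₀
    with gr , av-D ← avoids⇒good r down (avoids-tail av)
    with gl , av-u ← avoids⇒good l su (avoids-tail av-D) =
    ((λ b → [ avoids-hit av , avoids-hit av-D ]′ (from (hit-bin l r su) b)) , gl , gr) , av-u

  avoids-[] : Avoids Z []
  avoids-[] z z∈ (here p) = ¬hit-[] (z , z∈ , p)

  good⇔avoids : ∀ {s} → Good Bad s ⇔ Avoids Z (word s)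
  good⇔avoids {s} = mk⇔
    (λ g → subst (Avoids Z) (++-identityʳ (word s)) (good⇒avoids s end g avoids-[]))
    (λ av → proj₁ (avoids⇒good s end (subst (Avoids Z) (sym (++-identityʳ (word s))) av)))

-- The letter after the `U` of a vertex is `U` exactly when the right child has two children.
detects₁ : Detects Z₁ Bad₁
detects₁ = record
  { ¬hit-[]   = λ { (_ , here refl , ()) }
  ; ¬bad-leaf = λ ()
  ; hit-ll    = λ _ _ → mk⇔ (λ { (_ , here refl , () ∷ _) }) λ ()
  ; hit-rr    = λ _ _ → mk⇔ (λ { (_ , here refl , () ∷ _) }) λ ()
  ; hit-bin   = λ l r _ → mk⇔ (λ { (inj₁ h) → to r h ; (inj₂ (_ , here refl , () ∷ _)) })
      λ { bad → inj₁ (_ , here refl , refl ∷ refl ∷ []) }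
  }
  where
  to : ∀ {l} r {w} → Hit Z₁ (U ∷ word r ++ D ∷ w) → Bad₁ (bin l r)
  to leaf      (_ , here refl , _ ∷ () ∷ _)
  to (ll _)    (_ , here refl , _ ∷ () ∷ _)
  to (rr _)    (_ , here refl , _ ∷ () ∷ _)
  to (bin _ _) _ = bad

-- The letter after the `D` of a vertex comes from the left child. If that child is a leaf, the
-- letter lies beyond the word, and `Stop` keeps it from being `U`.
detects₂ : Detects Z₂ Bad₂
detects₂ = record
  { ¬hit-[]   = λ { (_ , here refl , ()) }
  ; ¬bad-leaf = λ ()
  ; hit-ll    = λ _ _ → mk⇔ (λ { (_ , here refl , () ∷ _) }) λ ()
  ; hit-rr    = λ _ _ → mk⇔ (λ { (_ , here refl , () ∷ _) }) λ ()
  ; hit-bin   = λ l r su → mk⇔ (λ { (inj₁ (_ , here refl , () ∷ _)) ; (inj₂ h) → to l su h })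
      λ { bad → inj₂ (_ , here refl , refl ∷ refl ∷ []) }
  }
  where
  to : ∀ l {r u} → Stop u → Hit Z₂ (D ∷ word l ++ u) → Bad₂ (bin l r)
  to leaf      end  (_ , here refl , _ ∷ ())
  to leaf      down (_ , here refl , _ ∷ () ∷ _)
  to (ll _)    _    (_ , here refl , _ ∷ () ∷ _)
  to (rr _)    _    (_ , here refl , _ ∷ () ∷ _)
  to (bin _ _) _    _ = bad

-- The first letters `U` and `Fᴿ` are those written by a vertex with a right child, whose word
-- follows at once; that word starts with `UU` or `UFᴸ` exactly when the child is `Bent`.
detects₃ : Detects Z₃ Bad₃
detects₃ = record
  { ¬hit-[]   = λ { (_ , here refl , ()) ; (_ , there (here refl) , ())
                  ; (_ , there (there (here refl)) , ()) ; (_ , there (there (there (here refl))) , ()) }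
  ; ¬bad-leaf = λ ()
  ; hit-ll    = λ _ _ → mk⇔
      (λ { (_ , here refl , () ∷ _) ; (_ , there (here refl) , () ∷ _)
         ; (_ , there (there (here refl)) , () ∷ _) ; (_ , there (there (there (here refl))) , () ∷ _) })
      λ ()
  ; hit-rr    = λ s su → mk⇔
      (λ { (_ , here refl , () ∷ _) ; (_ , there (here refl) , () ∷ _)
         ; (_ , there (there (here refl)) , _ ∷ p) → bad-rr (UU⇒bent s su p)
         ; (_ , there (there (there (here refl))) , _ ∷ p) → bad-rr (UFᴸ⇒bent s su p) })
      λ { (bad-rr bent-ll)  → _ , there (there (there (here refl))) , refl ∷ refl ∷ refl ∷ []
        ; (bad-rr bent-bin) → _ , there (there (here refl)) , refl ∷ refl ∷ refl ∷ [] }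
  ; hit-bin   = λ l r su → mk⇔
      (λ { (inj₁ (_ , here refl , _ ∷ p)) → bad-bin (UU⇒bent r down p)
         ; (inj₁ (_ , there (here refl) , _ ∷ p)) → bad-bin (UFᴸ⇒bent r down p)
         ; (inj₁ (_ , there (there (here refl)) , () ∷ _))
         ; (inj₁ (_ , there (there (there (here refl))) , () ∷ _))
         ; (inj₂ (_ , here refl , () ∷ _)) ; (inj₂ (_ , there (here refl) , () ∷ _))
         ; (inj₂ (_ , there (there (here refl)) , () ∷ _))
         ; (inj₂ (_ , there (there (there (here refl))) , () ∷ _)) })
      λ { (bad-bin bent-ll)  → inj₁ (_ , there (here refl) , refl ∷ refl ∷ refl ∷ [])
        ; (bad-bin bent-bin) → inj₁ (_ , here refl , refl ∷ refl ∷ refl ∷ []) }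
  }
  where
  UU⇒bent : ∀ s {u} → Stop u → Prefix _≡_ (U ∷ U ∷ []) (word s ++ u) → Bent s
  UU⇒bent leaf              end  ()
  UU⇒bent leaf              down (() ∷ _)
  UU⇒bent (ll _)            _    (() ∷ _)
  UU⇒bent (rr _)            _    (() ∷ _)
  UU⇒bent (bin _ leaf)      _    (_ ∷ () ∷ _)
  UU⇒bent (bin _ (ll _))    _    (_ ∷ () ∷ _)
  UU⇒bent (bin _ (rr _))    _    (_ ∷ () ∷ _)
  UU⇒bent (bin _ (bin _ _)) _    _ = bent-bin

  UFᴸ⇒bent : ∀ s {u} → Stop u → Prefix _≡_ (U ∷ Fᴸ ∷ []) (word s ++ u) → Bent s
  UFᴸ⇒bent leaf              end  ()
  UFᴸ⇒bent leaf              down (() ∷ _)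
  UFᴸ⇒bent (ll _)            _    (() ∷ _)
  UFᴸ⇒bent (rr _)            _    (() ∷ _)
  UFᴸ⇒bent (bin _ leaf)      _    (_ ∷ () ∷ _)
  UFᴸ⇒bent (bin _ (ll _))    _    _ = bent-ll
  UFᴸ⇒bent (bin _ (rr _))    _    (_ ∷ () ∷ _)
  UFᴸ⇒bent (bin _ (bin _ _)) _    (_ ∷ () ∷ _)

-- The bijections and the free entries of the patterns

toMotzkin-bijective : ∀ {k Z Bad n} {π : Pattern k} → 1 ≤ n → Detects Z Bad → Captures π Bad →
                      BijectiveOn toMotzkin (𝒯-avoiding n π) (ℳ′-avoiding (n ∸ 1) Z)
toMotzkin-bijective {Z = Z} {Bad} {n} {π} 1≤n det cap = maps , injective , surjective
  where
  open Detects det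
  open Equivalence

  -- Here n ≥ 1 excludes the empty tree, which shape and word cannot tell from a single vertex.
  𝒯⇒nonEmpty : ∀ {T} → 𝒯 n T → NonEmpty T
  𝒯⇒nonEmpty (_ , #≡n , _) = nonEmpty-# (subst (1 ≤_) (sym #≡n) 1≤n)

  maps : MapsTo toMotzkin (𝒯-avoiding n π) (ℳ′-avoiding (n ∸ 1) Z)
  maps T (T∈@(st , #≡n , _) , ¬c) rewrite toMotzkin≡word T =
    (cong (_∸ 1) (trans (word-length (shape T)) (trans (sym (#≡size (𝒯⇒nonEmpty T∈))) #≡n)) ,
     word-isMotzkin (shape T)) ,
    to good⇔avoids (¬occurs⇒good ¬bad-leaf T (¬c ∘ from (cap st)))

  injective : InjectiveOn toMotzkin (𝒯-avoiding n π)
  injective S T (S∈ , _) (T∈ , _) eq = begin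
    S               ≡⟨ label-shape (𝒯⇒nonEmpty S∈) S∈ ⟨
    label (shape S) ≡⟨ cong label (word-injective (trans (sym (toMotzkin≡word S)) (trans eq (toMotzkin≡word T)))) ⟩
    label (shape T) ≡⟨ label-shape (𝒯⇒nonEmpty T∈) T∈ ⟩
    T               ∎
    where open ≡-Reasoning

  surjective : SurjectiveOn toMotzkin (𝒯-avoiding n π) (ℳ′-avoiding (n ∸ 1) Z)
  surjective w ((len , mot) , av) with word-surjective mot
  ... | s , refl = label s ,
    (subst (λ k → 𝒯 k (label s)) size≡n (label-𝒯 s) , ¬contains) ,
    trans (toMotzkin≡word (label s)) (cong word (shape-label s))
    where
    size≡n : size s ≡ n
    size≡n = trans (sym (word-length s)) (trans (cong suc len) (m+[n∸m]≡n 1≤n))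
    ¬contains : ¬ Contains (label s) π
    ¬contains = good⇒¬occurs ¬bad-leaf (subst (Good Bad) (sym (shape-label s)) (from good⇔avoids av))
              ∘ to (cap (proj₁ (label-𝒯 s)))

captures⇒𝒯-avoiding-⇔ : ∀ {k Bad n T} {π ρ : Pattern k} → Captures π Bad → Captures ρ Bad →
                        𝒯-avoiding n π T ⇔ 𝒯-avoiding n ρ T
captures⇒𝒯-avoiding-⇔ cap-π cap-ρ = mk⇔
  (λ { (T∈@(st , _) , ¬c) → T∈ , ¬c ∘ from (cap-π st) ∘ to (cap-ρ st) })
  (λ { (T∈@(st , _) , ¬c) → T∈ , ¬c ∘ from (cap-ρ st) ∘ to (cap-π st) })
  where open Equivalence

-- A common encoding of the three classes

-- The six monomials of x(1 + 2G)(1 + xG): `α` and `β` are the two summands of 2G, `γ` is xG, and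
-- `weight` adds up the exponents of x.
data Layer (A : Set) : Set where
  one   : Layer A
  α β γ : A → Layer A
  αγ βγ : A → A → Layer A

weight : Layer Shape → ℕ
weight one      = 1
weight (α s)    = suc (size s)
weight (β s)    = suc (size s)
weight (γ s)    = 2 + size s
weight (αγ s t) = 2 + (size s + size t)
weight (βγ s t) = 2 + (size s + size t)

AllLayer : (Shape → Set) → Layer Shape → Set
AllLayer P one      = ⊤
AllLayer P (α s)    = P s
AllLayer P (β s)    = P s
AllLayer P (γ s)    = P s
AllLayer P (αγ s t) = P s × P t
AllLayer P (βγ s t) = P s × P t

-- The generating function of codes by index satisfies G = x(1 + 2G)(1 + xG).
data Code : ℕ → Set where
  one   : Code 1
  α β   : ∀ {n} → Code n → Code (1 + n)
  γ     : ∀ {n} → Code n → Code (2 + n)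
  -- The sum is held as an equation so that two codes of one index can be matched without unifying
  -- two sums; such equations are irrelevant.
  αγ βγ : ∀ {n i j} → i + j ≡ n → Code i → Code j → Code (2 + n)

α-injective : ∀ {A} {s t : A} → Layer.α s ≡ α t → s ≡ t
α-injective refl = refl

β-injective : ∀ {A} {s t : A} → Layer.β s ≡ β t → s ≡ t
β-injective refl = refl

γ-injective : ∀ {A} {s t : A} → Layer.γ s ≡ γ t → s ≡ t
γ-injective refl = refl

αγ-injective : ∀ {A} {s t u v : A} → Layer.αγ s t ≡ αγ u v → s ≡ u × t ≡ v
αγ-injective refl = refl , refl

βγ-injective : ∀ {A} {s t u v : A} → Layer.βγ s t ≡ βγ u v → s ≡ u × t ≡ v
βγ-injective refl = refl , refl

-- One level of the decomposition at the root. `unstep` is total and takes a junk value on shapes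
-- that are bad at the root, so only `step-unstep` carries a side condition.
record Encoding (Bad : Shape → Set) : Set where
  field
    step        : Layer Shape → Shape
    unstep      : Shape → Layer Shape
    unstep-step : ∀ x → unstep (step x) ≡ x
    step-unstep : ∀ s → ¬ Bad s → step (unstep s) ≡ s
    size-step   : ∀ x → size (step x) ≡ weight x
    good-step   : ∀ x → AllLayer (Good Bad) x → Good Bad (step x)
    good-unstep : ∀ s → Good Bad s → AllLayer (Good Bad) (unstep s)

  decode : ∀ {n} → Code n → Shape
  layer  : ∀ {n} → Code n → Layer Shape

  decode p = step (layer p)

  layer one        = one
  layer (α p)      = α (decode p)
  layer (β p)      = β (decode p)
  layer (γ p)      = γ (decode p)
  layer (αγ _ p q) = αγ (decode p) (decode q)
  layer (βγ _ p q) = βγ (decode p) (decode q)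

  size-decode : ∀ {n} (p : Code n) → size (decode p) ≡ n
  size-decode one           = size-step _
  size-decode (α p)         = trans (size-step _) (cong suc (size-decode p))
  size-decode (β p)         = trans (size-step _) (cong suc (size-decode p))
  size-decode (γ p)         = trans (size-step _) (cong (2 +_) (size-decode p))
  size-decode (αγ refl p q) = trans (size-step _) (cong (2 +_) (cong₂ _+_ (size-decode p) (size-decode q)))
  size-decode (βγ refl p q) = trans (size-step _) (cong (2 +_) (cong₂ _+_ (size-decode p) (size-decode q)))

  good-decode : ∀ {n} (p : Code n) → Good Bad (decode p)
  good-decode one        = good-step _ tt
  good-decode (α p)      = good-step _ (good-decode p)
  good-decode (β p)      = good-step _ (good-decode p)
  good-decode (γ p)      = good-step _ (good-decode p)
  good-decode (αγ _ p q) = good-step _ (good-decode p , good-decode q)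
  good-decode (βγ _ p q) = good-step _ (good-decode p , good-decode q)

  step-injective : ∀ {x y} → step x ≡ step y → x ≡ y
  step-injective {x} {y} eq = trans (sym (unstep-step x)) (trans (cong unstep eq) (unstep-step y))

  decode-index : ∀ {m n} (p : Code m) (q : Code n) → decode p ≡ decode q → m ≡ n
  decode-index p q eq = trans (sym (size-decode p)) (trans (cong size eq) (size-decode q))

  decode-injective : ∀ {n} (p q : Code n) → decode p ≡ decode q → p ≡ q
  layer-injective  : ∀ {n} (p q : Code n) → layer p ≡ layer q → p ≡ q

  decode-injective p q eq = layer-injective p q (step-injective eq)

  layer-injective one   one   _  = refl
  layer-injective (α p) (α q) eq = cong α (decode-injective p q (α-injective eq))
  layer-injective (β p) (β q) eq = cong β (decode-injective p q (β-injective eq))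
  layer-injective (γ p) (γ q) eq = cong γ (decode-injective p q (γ-injective eq))
  layer-injective (αγ e p p′) (αγ e′ q q′) eq
    with eq₁ , eq₂ ← αγ-injective eq
    with refl ← decode-index p q eq₁ | refl ← decode-index p′ q′ eq₂
    with refl ← decode-injective p q eq₁ | refl ← decode-injective p′ q′ eq₂
    with refl ← ≡-irrelevant e e′ = refl
  layer-injective (βγ e p p′) (βγ e′ q q′) eq
    with eq₁ , eq₂ ← βγ-injective eq
    with refl ← decode-index p q eq₁ | refl ← decode-index p′ q′ eq₂
    with refl ← decode-injective p q eq₁ | refl ← decode-injective p′ q′ eq₂
    with refl ← ≡-irrelevant e e′ = refl

  below : ∀ {k m s} x → size s ≤ k → step x ≡ s → m < weight x → m < k
  below x s≤k refl m<w = <-≤-trans m<w (≤-trans (≤-reflexive (sym (size-step x))) s≤k)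

  -- Recursion on a bound k for the size: unstep is not structurally decreasing.
  encode  : ∀ k s → size s < k → Good Bad s → Σ[ n ∈ ℕ ] Σ[ p ∈ Code n ] decode p ≡ s
  encode′ : ∀ k x {s} → size s ≤ k → step x ≡ s → AllLayer (Good Bad) x →
            Σ[ n ∈ ℕ ] Σ[ p ∈ Code n ] decode p ≡ s

  encode (suc k) s s<k g =
    encode′ k (unstep s) (s≤s⁻¹ s<k) (step-unstep s (good-root s g)) (good-unstep s g)

  encode′ k one   s≤k eq _ = _ , one , eq
  encode′ k x@(α t) s≤k eq g with _ , p , refl ← encode k t (below x s≤k eq ≤-refl) g = _ , α p , eq
  encode′ k x@(β t) s≤k eq g with _ , p , refl ← encode k t (below x s≤k eq ≤-refl) g = _ , β p , eq
  encode′ k x@(γ t) s≤k eq g with _ , p , refl ← encode k t (below x s≤k eq (n≤1+n _)) g = _ , γ p , eq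
  encode′ k x@(αγ t u) s≤k eq (g , h)
    with _ , p , refl ← encode k t (below x s≤k eq (m≤n⇒m≤1+n (s≤s (m≤m+n _ _)))) g
       | _ , q , refl ← encode k u (below x s≤k eq (m≤n⇒m≤1+n (s≤s (m≤n+m _ (size t))))) h
    = _ , αγ refl p q , eq
  encode′ k x@(βγ t u) s≤k eq (g , h)
    with _ , p , refl ← encode k t (below x s≤k eq (m≤n⇒m≤1+n (s≤s (m≤m+n _ _)))) g
       | _ , q , refl ← encode k u (below x s≤k eq (m≤n⇒m≤1+n (s≤s (m≤n+m _ (size t))))) h
    = _ , βγ refl p q , eq

  decode-surjective : ∀ s → Good Bad s → Σ[ p ∈ Code (size s) ] decode p ≡ s
  decode-surjective s g with encode (suc (size s)) s ≤-refl g
  ... | n , p , eq with refl ← trans (sym (size-decode p)) (cong size eq) = p , eq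

-- Below a vertex with two children, the right child has at most one child, so such a vertex
-- contributes xG · x(1 + 2G); the left subtree is an arbitrary good shape.
encoding₁ : Encoding Bad₁
encoding₁ = record
  { step        = step
  ; unstep      = unstep
  ; unstep-step = λ { one → refl ; (α _) → refl ; (β _) → refl ; (γ _) → refl ; (αγ _ _) → refl ; (βγ _ _) → refl }
  ; step-unstep = λ { leaf _ → refl ; (ll _) _ → refl ; (rr _) _ → refl
                    ; (bin _ leaf) _ → refl ; (bin _ (ll _)) _ → refl ; (bin _ (rr _)) _ → refl
                    ; (bin _ (bin _ _)) ¬b → contradiction bad ¬b }
  ; size-step   = λ { one → refl ; (α _) → refl ; (β _) → refl
                    ; (γ s) → cong suc (+-comm (size s) 1)
                    ; (αγ s t) → cong suc (+-suc (size s) (size t))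
                    ; (βγ s t) → cong suc (+-suc (size s) (size t)) }
  ; good-step   = λ { one _ → (λ ()) ; (α _) g → (λ ()) , g ; (β _) g → (λ ()) , g
                    ; (γ _) g → (λ ()) , g , λ ()
                    ; (αγ _ _) (g , h) → (λ ()) , g , (λ ()) , h
                    ; (βγ _ _) (g , h) → (λ ()) , g , (λ ()) , h }
  ; good-unstep = λ { leaf _ → tt ; (ll _) (_ , g) → g ; (rr _) (_ , g) → g
                    ; (bin _ leaf) (_ , g , _) → g
                    ; (bin _ (ll _)) (_ , g , _ , h) → g , h
                    ; (bin _ (rr _)) (_ , g , _ , h) → g , h
                    ; (bin _ (bin _ _)) _ → tt }
  }
  where
  step : Layer Shape → Shape
  step one      = leaf
  step (α s)    = ll s
  step (β s)    = rr s
  step (γ s)    = bin s leaf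
  step (αγ s t) = bin s (ll t)
  step (βγ s t) = bin s (rr t)

  unstep : Shape → Layer Shape
  unstep leaf              = one
  unstep (ll s)            = α s
  unstep (rr s)            = β s
  unstep (bin l leaf)      = γ l
  unstep (bin l (ll r))    = αγ l r
  unstep (bin l (rr r))    = βγ l r
  unstep (bin _ (bin _ _)) = one

-- As before with the roles of the two subtrees exchanged.
encoding₂ : Encoding Bad₂
encoding₂ = record
  { step        = step
  ; unstep      = unstep
  ; unstep-step = λ { one → refl ; (α _) → refl ; (β _) → refl ; (γ _) → refl ; (αγ _ _) → refl ; (βγ _ _) → refl }
  ; step-unstep = λ { leaf _ → refl ; (ll _) _ → refl ; (rr _) _ → refl
                    ; (bin leaf _) _ → refl ; (bin (ll _) _) _ → refl ; (bin (rr _) _) _ → refl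
                    ; (bin (bin _ _) _) ¬b → contradiction bad ¬b }
  ; size-step   = λ { one → refl ; (α _) → refl ; (β _) → refl ; (γ _) → refl ; (αγ _ _) → refl ; (βγ _ _) → refl }
  ; good-step   = λ { one _ → (λ ()) ; (α _) g → (λ ()) , g ; (β _) g → (λ ()) , g
                    ; (γ _) g → (λ ()) , (λ ()) , g
                    ; (αγ _ _) (g , h) → (λ ()) , ((λ ()) , g) , h
                    ; (βγ _ _) (g , h) → (λ ()) , ((λ ()) , g) , h }
  ; good-unstep = λ { leaf _ → tt ; (ll _) (_ , g) → g ; (rr _) (_ , g) → g
                    ; (bin leaf _) (_ , _ , g) → g
                    ; (bin (ll _) _) (_ , (_ , g) , h) → g , h
                    ; (bin (rr _) _) (_ , (_ , g) , h) → g , h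
                    ; (bin (bin _ _) _) _ → tt }
  }
  where
  step : Layer Shape → Shape
  step one      = leaf
  step (α s)    = ll s
  step (β s)    = rr s
  step (γ s)    = bin leaf s
  step (αγ s t) = bin (ll s) t
  step (βγ s t) = bin (rr s) t

  unstep : Shape → Layer Shape
  unstep leaf              = one
  unstep (ll s)            = α s
  unstep (rr s)            = β s
  unstep (bin leaf r)      = γ r
  unstep (bin (ll l) r)    = αγ l r
  unstep (bin (rr l) r)    = βγ l r
  unstep (bin (bin _ _) _) = one

-- Let R count the good shapes that are not Bent, and K the good shapes whose
-- root has no left child.  Then G = K (1 + G), K = x (1 + R) = x (1 + K)(1 + x G),
-- and (1 + K)(1 + G) = 1 + 2 G turns this into the equation of codes.  In step
-- the last identity reads: in β t and βγ t s the left subtree of t moves up to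
-- the new root, whose right child becomes the rest of t (with s added on its left).
encoding₃ : Encoding Bad₃
encoding₃ = record
  { step        = step
  ; unstep      = unstep
  ; unstep-step = unstep-step
  ; step-unstep = step-unstep
  ; size-step   = size-step
  ; good-step   = good-step
  ; good-unstep = good-unstep
  }
  where
  step : Layer Shape → Shape
  step one              = leaf
  step (α s)            = ll s
  step (β leaf)         = rr leaf
  step (β (ll l))       = bin l leaf
  step (β (rr r))       = rr (rr r)
  step (β (bin l r))    = bin l (rr r)
  step (γ s)            = rr (ll s)
  step (αγ s t)         = bin s (ll t)
  step (βγ leaf s)      = rr (bin s leaf)
  step (βγ (ll l) s)    = bin l (bin s leaf)
  step (βγ (rr r) s)    = rr (bin s (rr r))
  step (βγ (bin l r) s) = bin l (bin s (rr r))

  unstep : Shape → Layer Shape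
  unstep leaf                      = one
  unstep (ll s)                    = α s
  unstep (rr leaf)                 = β leaf
  unstep (bin l leaf)              = β (ll l)
  unstep (rr (rr r))               = β (rr r)
  unstep (bin l (rr r))            = β (bin l r)
  unstep (rr (ll s))               = γ s
  unstep (bin s (ll t))            = αγ s t
  unstep (rr (bin s leaf))         = βγ leaf s
  unstep (bin l (bin s leaf))      = βγ (ll l) s
  unstep (rr (bin s (rr r)))       = βγ (rr r) s
  unstep (bin l (bin s (rr r)))    = βγ (bin l r) s
  unstep (rr (bin _ (ll _)))       = one
  unstep (rr (bin _ (bin _ _)))    = one
  unstep (bin _ (bin _ (ll _)))    = one
  unstep (bin _ (bin _ (bin _ _))) = one

  unstep-step : ∀ x → unstep (step x) ≡ x
  unstep-step one              = refl
  unstep-step (α _)            = refl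
  unstep-step (β leaf)         = refl
  unstep-step (β (ll _))       = refl
  unstep-step (β (rr _))       = refl
  unstep-step (β (bin _ _))    = refl
  unstep-step (γ _)            = refl
  unstep-step (αγ _ _)         = refl
  unstep-step (βγ leaf _)      = refl
  unstep-step (βγ (ll _) _)    = refl
  unstep-step (βγ (rr _) _)    = refl
  unstep-step (βγ (bin _ _) _) = refl

  step-unstep : ∀ s → ¬ Bad₃ s → step (unstep s) ≡ s
  step-unstep leaf                      _  = refl
  step-unstep (ll _)                    _  = refl
  step-unstep (rr leaf)                 _  = refl
  step-unstep (rr (ll _))               _  = refl
  step-unstep (rr (rr _))               _  = refl
  step-unstep (rr (bin _ leaf))         _  = refl
  step-unstep (rr (bin _ (ll _)))       ¬b = contradiction (bad-rr bent-ll) ¬b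
  step-unstep (rr (bin _ (rr _)))       _  = refl
  step-unstep (rr (bin _ (bin _ _)))    ¬b = contradiction (bad-rr bent-bin) ¬b
  step-unstep (bin _ leaf)              _  = refl
  step-unstep (bin _ (ll _))            _  = refl
  step-unstep (bin _ (rr _))            _  = refl
  step-unstep (bin _ (bin _ leaf))      _  = refl
  step-unstep (bin _ (bin _ (ll _)))    ¬b = contradiction (bad-bin bent-ll) ¬b
  step-unstep (bin _ (bin _ (rr _)))    _  = refl
  step-unstep (bin _ (bin _ (bin _ _))) ¬b = contradiction (bad-bin bent-bin) ¬b

  size-step : ∀ x → size (step x) ≡ weight x
  size-step one              = refl
  size-step (α _)            = refl
  size-step (β leaf)         = refl
  size-step (β (ll l))       = cong suc (+-comm (size l) 1)
  size-step (β (rr _))       = refl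
  size-step (β (bin l r))    = cong suc (+-suc (size l) (size r))
  size-step (γ _)            = refl
  size-step (αγ s t)         = cong suc (+-suc (size s) (size t))
  size-step (βγ leaf s)      = cong (2 +_) (+-comm (size s) 1)
  size-step (βγ (ll l) s)    = eq (size l) (size s)
    where
    eq : ∀ l s → 1 + (l + (1 + (s + 1))) ≡ 2 + (1 + l + s)
    eq = solve-∀
  size-step (βγ (rr r) s)    = cong (2 +_) (+-comm (size s) (suc (size r)))
  size-step (βγ (bin l r) s) = eq (size l) (size r) (size s)
    where
    eq : ∀ l r s → 1 + (l + (1 + (s + (1 + r)))) ≡ 2 + (1 + (l + r) + s)
    eq = solve-∀

  -- `Bad₃` inspects only the right subtree, so a left subtree can be moved to a new root freely.
  bin⇒rr : ∀ {l r} → ¬ Bad₃ (bin l r) → ¬ Bad₃ (rr r)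
  bin⇒rr ¬b (bad-rr t) = ¬b (bad-bin t)

  rr⇒bin : ∀ {l r} → ¬ Bad₃ (rr r) → ¬ Bad₃ (bin l r)
  rr⇒bin ¬b (bad-bin t) = ¬b (bad-rr t)

  -- No right child created by `step` is `Bent`: it is `leaf`, an `ll`, an `rr`, or a `bin` whose
  -- right part is `leaf` or an `rr`. All else is inherited from the layer.
  good-step : ∀ x → AllLayer (Good Bad₃) x → Good Bad₃ (step x)
  good-step one              _                 = λ ()
  good-step (α _)            g                 = (λ ()) , g
  good-step (β leaf)         g                 = (λ { (bad-rr ()) }) , g
  good-step (β (ll _))       (_ , g)           = (λ { (bad-bin ()) }) , g , λ ()
  good-step (β (rr _))       g                 = (λ { (bad-rr ()) }) , g
  good-step (β (bin _ _))    (¬b , gl , gr)    = (λ { (bad-bin ()) }) , gl , bin⇒rr ¬b , gr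
  good-step (γ _)            g                 = (λ { (bad-rr ()) }) , (λ ()) , g
  good-step (αγ _ _)         (g , h)           = (λ { (bad-bin ()) }) , g , (λ ()) , h
  good-step (βγ leaf _)      (_ , h)           = (λ { (bad-rr ()) }) , (λ { (bad-bin ()) }) , h , λ ()
  good-step (βγ (ll _) _)    ((_ , g) , h)     = (λ { (bad-bin ()) }) , g , (λ { (bad-bin ()) }) , h , λ ()
  good-step (βγ (rr _) _)    (g , h)           = (λ { (bad-rr ()) }) , (λ { (bad-bin ()) }) , h , g
  good-step (βγ (bin _ _) _) ((¬b , gl , gr) , h) =
    (λ { (bad-bin ()) }) , gl , (λ { (bad-bin ()) }) , h , bin⇒rr ¬b , gr

  good-unstep : ∀ s → Good Bad₃ s → AllLayer (Good Bad₃) (unstep s)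
  good-unstep leaf                      _           = tt
  good-unstep (ll _)                    (_ , g)     = g
  good-unstep (rr leaf)                 _           = λ ()
  good-unstep (rr (ll _))               (_ , _ , g) = g
  good-unstep (rr (rr _))               (_ , g)     = g
  good-unstep (rr (bin _ leaf))         (_ , _ , h , _) = (λ ()) , h
  good-unstep (rr (bin _ (ll _)))       _           = tt
  good-unstep (rr (bin _ (rr _)))       (_ , _ , h , g) = g , h
  good-unstep (rr (bin _ (bin _ _)))    _           = tt
  good-unstep (bin _ leaf)              (_ , g , _) = (λ ()) , g
  good-unstep (bin _ (ll _))            (_ , g , _ , h) = g , h
  good-unstep (bin _ (rr _))            (_ , gl , ¬b , gr) = rr⇒bin ¬b , gl , gr
  good-unstep (bin _ (bin _ leaf))      (_ , g , _ , h , _) = ((λ ()) , g) , h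
  good-unstep (bin _ (bin _ (ll _)))    _           = tt
  good-unstep (bin _ (bin _ (rr _)))    (_ , gl , _ , h , ¬b , gr) = (rr⇒bin ¬b , gl , gr) , h
  good-unstep (bin _ (bin _ (bin _ _))) _           = tt

-- The number of codes

sum-cong : ∀ {f g} n → (∀ i → i < n → f i ≡ g i) → sum (applyUpTo f n) ≡ sum (applyUpTo g n)
sum-cong zero    _  = refl
sum-cong (suc n) eq = cong₂ _+_ (eq 0 (s≤s z≤n)) (sum-cong n λ i i<n → eq (suc i) (s≤s i<n))

⊛≡sum : ∀ f g n → (f ⊛ g) n ≡ sum (applyUpTo (λ i → f i * g (n ∸ i)) (suc n))
⊛≡sum f g n = cong sum (map-upTo (λ i → f i * g (n ∸ i)) (suc n))

⊛-cong : ∀ {f g} n → (∀ i → i ≤ n → f i ≡ g i) → (f ⊛ f) n ≡ (g ⊛ g) n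
⊛-cong {f} {g} n eq = trans (⊛≡sum f f n) (trans
  (sum-cong (suc n) λ i i<1+n → cong₂ _*_ (eq i (s≤s⁻¹ i<1+n)) (eq (n ∸ i) (m∸n≤m n i)))
  (sym (⊛≡sum g g n)))

poly-[]-⊛ : ∀ g n → (poly [] ⊛ g) n ≡ 0
poly-[]-⊛ g n = trans (⊛≡sum (poly []) g n) (zeros (suc n))
  where
  zeros : ∀ m → sum (applyUpTo (λ _ → 0) m) ≡ 0
  zeros zero    = refl
  zeros (suc m) = zeros m

-- Shifting the summation index by one turns `poly (k ∷ cs)` into `poly cs` and keeps the other
-- argument, both by computation.
poly-∷-⊛ : ∀ k cs g n → (poly (k ∷ cs) ⊛ g) (suc n) ≡ k * g (suc n) + (poly cs ⊛ g) n
poly-∷-⊛ k cs g n = trans (⊛≡sum (poly (k ∷ cs)) g (suc n))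
  (cong (k * g (suc n) +_) (sym (⊛≡sum (poly cs) g n)))

constant-⊛ : ∀ k g n → (poly (k ∷ []) ⊛ g) n ≡ k * g n
constant-⊛ k g zero    = +-identityʳ (k * g 0)
constant-⊛ k g (suc n) = trans (poly-∷-⊛ k [] g n)
  (trans (cong (k * g (suc n) +_) (poly-[]-⊛ g n)) (+-identityʳ _))

-- The equation of `IsA159771` read coefficientwise; the doubled terms are written out so that the
-- summands match the disjoint union in `code-unfold`.
recur : Series → Series
recur f 0             = 0
recur f 1             = 1
recur f (suc (suc n)) = f (suc n) + (f (suc n) + (f n + ((f ⊛ f) n + (f ⊛ f) n)))

recur-cong : ∀ {f g} n → (∀ i → i < n → f i ≡ g i) → recur f n ≡ recur g n
recur-cong 0             eq = refl
recur-cong 1             eq = refl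
recur-cong (suc (suc n)) eq = cong₂ _+_ f≡₁ (cong₂ _+_ f≡₁ (cong₂ _+_ (eq n (n≤1+n _)) (cong₂ _+_ ff≡ ff≡)))
  where
  f≡₁ = eq (suc n) ≤-refl
  ff≡ = ⊛-cong n λ i i≤n → eq i (s≤s (m≤n⇒m≤1+n i≤n))

-- Iteration towards the fixed point of `recur`. Since `recur` at n reads only values below n, k
-- rounds settle all coefficients below k; `codes n` therefore takes n + 1 rounds.
approx : ℕ → Series
approx zero    = λ _ → 0
approx (suc k) = recur (approx k)

codes : Series
codes n = approx (suc n) n

approx-stable : ∀ k m {n} → n < k → n < m → approx k n ≡ approx m n
approx-stable (suc k) (suc m) {n} n<1+k n<1+m = recur-cong n λ i i<n →
  approx-stable k m (<-≤-trans i<n (s≤s⁻¹ n<1+k)) (<-≤-trans i<n (s≤s⁻¹ n<1+m))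

codes-recur : ∀ n → codes n ≡ recur codes n
codes-recur n = recur-cong n λ i i<n → approx-stable n (suc i) i<n ≤-refl

codes-isA159771 : IsA159771 codes
codes-isA159771 0 = refl
codes-isA159771 1 = refl
codes-isA159771 (suc (suc n)) = begin
  codes (2 + n)
    ≡⟨ codes-recur (2 + n) ⟩
  codes (1 + n) + (codes (1 + n) + (codes n + (k + k)))
    ≡⟨ rearrange (codes (1 + n)) (codes n) k ⟩
  (2 * codes (1 + n) + 1 * codes n) + 2 * k
    ≡⟨ cong₂ _+_ linear quadratic ⟨
  (poly (0 ∷ 2 ∷ 1 ∷ []) ⊛ codes) (2 + n) + (poly (0 ∷ 0 ∷ 2 ∷ []) ⊛ (codes ⊛ codes)) (2 + n) ∎
  where
  open ≡-Reasoning
  k : ℕ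
  k = (codes ⊛ codes) n

  rearrange : ∀ x y z → x + (x + (y + (z + z))) ≡ (2 * x + 1 * y) + 2 * z
  rearrange = solve-∀

  linear : (poly (0 ∷ 2 ∷ 1 ∷ []) ⊛ codes) (2 + n) ≡ 2 * codes (1 + n) + 1 * codes n
  linear = trans (poly-∷-⊛ 0 (2 ∷ 1 ∷ []) codes (1 + n)) (trans (poly-∷-⊛ 2 (1 ∷ []) codes n)
    (cong (2 * codes (1 + n) +_) (constant-⊛ 1 codes n)))

  quadratic : (poly (0 ∷ 0 ∷ 2 ∷ []) ⊛ (codes ⊛ codes)) (2 + n) ≡ 2 * k
  quadratic = trans (poly-∷-⊛ 0 (0 ∷ 2 ∷ []) (codes ⊛ codes) (1 + n))
    (trans (poly-∷-⊛ 0 (2 ∷ []) (codes ⊛ codes) n) (constant-⊛ 2 (codes ⊛ codes) n))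

-- Convolution of types and the counting of codes

Split : (ℕ → ℕ → Set) → ℕ → Set
Split P n = Σ[ i ∈ ℕ ] Σ[ j ∈ ℕ ] i + j ≡ n × P i j

-- The summand `⊥` stands for the final `+ 0` of `sum`, so that the counts agree without arithmetic.
split-zero : ∀ {P} → Split P 0 ↔ (P 0 0 ⊎ ⊥)
split-zero = mk↔ₛ′ (λ { (zero , _ , refl , x) → inj₁ x }) (λ { (inj₁ x) → zero , zero , refl , x })
  (λ { (inj₁ _) → refl }) (λ { (zero , _ , refl , _) → refl })

split-suc : ∀ {P n} → Split P (suc n) ↔ (P 0 (suc n) ⊎ Split (P ∘ suc) n)
split-suc = mk↔ₛ′
  (λ { (zero , _ , refl , x) → inj₁ x ; (suc i , j , refl , x) → inj₂ (i , j , refl , x) })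
  (λ { (inj₁ x) → zero , _ , refl , x ; (inj₂ (i , j , refl , x)) → suc i , j , refl , x })
  (λ { (inj₁ _) → refl ; (inj₂ (_ , _ , refl , _)) → refl })
  (λ { (zero , _ , refl , _) → refl ; (suc _ , _ , refl , _) → refl })

-- Splitting off i = 0 and shifting i follows the recursion of `applyUpTo`; a two-argument h lets
-- the shift act on i alone.
split-count : ∀ {P} {h : ℕ → ℕ → ℕ} n → (∀ i j → i + j ≡ n → P i j ↔ Fin (h i j)) →
              Split P n ↔ Fin (sum (applyUpTo (λ i → h i (n ∸ i)) (suc n)))
split-count zero    P↔ = ↔-trans split-zero (↔-trans (P↔ 0 0 refl ⊎-↔ ↔-sym 0↔⊥) (↔-sym +↔⊎))
split-count {h = h} (suc n) P↔ = ↔-trans split-suc (↔-trans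
  (P↔ 0 (suc n) refl ⊎-↔ split-count {h = h ∘ suc} n λ i j eq → P↔ (suc i) j (cong suc eq))
  (↔-sym +↔⊎))

Pair : ℕ → Set
Pair = Split (λ i j → Code i × Code j)

code-unfold : ∀ {n} → Code (2 + n) ↔ (Code (1 + n) ⊎ (Code (1 + n) ⊎ (Code n ⊎ (Pair n ⊎ Pair n))))
code-unfold = mk↔ₛ′
  (λ { (α p) → inj₁ p ; (β p) → inj₂ (inj₁ p) ; (γ p) → inj₂ (inj₂ (inj₁ p))
     ; (αγ e p q) → inj₂ (inj₂ (inj₂ (inj₁ (_ , _ , e , p , q))))
     ; (βγ e p q) → inj₂ (inj₂ (inj₂ (inj₂ (_ , _ , e , p , q)))) })
  (λ { (inj₁ p) → α p ; (inj₂ (inj₁ p)) → β p ; (inj₂ (inj₂ (inj₁ p))) → γ p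
     ; (inj₂ (inj₂ (inj₂ (inj₁ (_ , _ , e , p , q))))) → αγ e p q
     ; (inj₂ (inj₂ (inj₂ (inj₂ (_ , _ , e , p , q))))) → βγ e p q })
  (λ { (inj₁ _) → refl ; (inj₂ (inj₁ _)) → refl ; (inj₂ (inj₂ (inj₁ _))) → refl
     ; (inj₂ (inj₂ (inj₂ (inj₁ _)))) → refl ; (inj₂ (inj₂ (inj₂ (inj₂ _)))) → refl })
  (λ { (α _) → refl ; (β _) → refl ; (γ _) → refl ; (αγ _ _ _) → refl ; (βγ _ _ _) → refl })

code-one : Code 1 ↔ ⊤
code-one = mk↔ₛ′ (λ _ → tt) (λ _ → one) (λ _ → refl) (λ { one → refl ; (α ()) ; (β ()) })

code-count : ∀ n → Code n ↔ Fin (codes n)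
code-count = <-rec _ count
  where
  count : ∀ n → (∀ {m} → m < n → Code m ↔ Fin (codes m)) → Code n ↔ Fin (codes n)
  count 0 _ = mk↔ₛ′ (λ ()) (λ ()) (λ ()) (λ ())
  count 1 _ = ↔-trans code-one (↔-sym 1↔⊤)
  count (suc (suc n)) rec = subst (λ m → Code (2 + n) ↔ Fin m) (sym (codes-recur (2 + n)))
    (↔-trans code-unfold (rec₁ ⊕↔ (rec₁ ⊕↔ (rec (n≤1+n _) ⊕↔ (pairs ⊕↔ pairs)))))
    where
    rec₁ : Code (1 + n) ↔ Fin (codes (1 + n))
    rec₁ = rec ≤-refl

    _⊕↔_ : ∀ {A B : Set} {k m} → A ↔ Fin k → B ↔ Fin m → (A ⊎ B) ↔ Fin (k + m)
    p ⊕↔ q = ↔-trans (p ⊎-↔ q) (↔-sym +↔⊎)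

    pairs : Pair n ↔ Fin ((codes ⊛ codes) n)
    pairs = subst (λ m → Pair n ↔ Fin m) (sym (⊛≡sum codes codes n))
      (split-count {h = λ i j → codes i * codes j} n λ i j eq → ↔-trans
        (rec (s≤s (m≤n⇒m≤1+n (subst (i ≤_) eq (m≤m+n i j)))) ×-↔
         rec (s≤s (m≤n⇒m≤1+n (subst (j ≤_) eq (m≤n+m j i)))))
        (↔-sym *↔×))

ℳ′-avoiding-cardinality : ∀ {Z Bad n} → Detects Z Bad → Encoding Bad → 1 ≤ n →
                          HasCardinality (ℳ′-avoiding (n ∸ 1) Z) (codes n)
ℳ′-avoiding-cardinality {Z} {Bad} {n} det enc 1≤n = g , maps , injective , surjective
  where
  open Detects det
  open Encoding enc
  open Inverse (code-count n) using (strictlyInverseʳ; strictlyInverseˡ) renaming (to to rank; from to unrank)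
  open Equivalence

  g : Fin (codes n) → List Step
  g i = word (decode (unrank i))

  maps : MapsTo g (λ _ → ⊤) (ℳ′-avoiding (n ∸ 1) Z)
  maps i _ = (cong (_∸ 1) (trans (word-length (decode p)) (size-decode p)) , word-isMotzkin (decode p)) ,
    to good⇔avoids (good-decode p)
    where
    p : Code n
    p = unrank i

  injective : InjectiveOn g (λ _ → ⊤)
  injective i j _ _ eq = trans (sym (strictlyInverseˡ i)) (trans
    (cong rank (decode-injective (unrank i) (unrank j) (word-injective eq))) (strictlyInverseˡ j))

  surjective : SurjectiveOn g (λ _ → ⊤) (ℳ′-avoiding (n ∸ 1) Z)
  surjective w ((len , mot) , av) with word-surjective mot
  ... | s , refl
    with refl ← trans (sym (word-length s)) (trans (cong suc len) (m+[n∸m]≡n 1≤n))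
    with p , eq ← decode-surjective s (from good⇔avoids av) =
    rank p , tt , cong word (trans (cong decode (strictlyInverseʳ p)) eq)

theorem13 : (∀ (n : ℕ) → 1 ≤ n →
    BijectiveOn toMotzkin (𝒯-avoiding n ⟨21435, 1111F ⟩) (ℳ′-avoiding (n ∸ 1) Z₁)
    × BijectiveOn toMotzkin (𝒯-avoiding n ⟨42135, 1111F ⟩) (ℳ′-avoiding (n ∸ 1) Z₂)
    × BijectiveOn toMotzkin (𝒯-avoiding n ⟨13254, 1111F ⟩) (ℳ′-avoiding (n ∸ 1) Z₃))
    × (∀ (n : ℕ) (T : Tree) →
    (∀ (x y z : Fin 2) → 𝒯-avoiding n ⟨21435, 1111F ⟩ T ⇔ 𝒯-avoiding n ⟨21435, x ∷ 1F ∷ y ∷ z ∷ [] ⟩ T)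
    × (∀ (x y z : Fin 2) → 𝒯-avoiding n ⟨42135, 1111F ⟩ T ⇔ 𝒯-avoiding n ⟨42135, 1F ∷ x ∷ y ∷ z ∷ [] ⟩ T)
    × (∀ (x y : Fin 2) → 𝒯-avoiding n ⟨13254, 1111F ⟩ T ⇔ 𝒯-avoiding n ⟨13254, 1F ∷ x ∷ 1F ∷ y ∷ [] ⟩ T))
    × (Σ[ a ∈ (ℕ → ℕ) ] IsA159771 a
    × (applyUpTo (λ i → a (suc i)) 10 ≡ 1 ∷ 2 ∷ 5 ∷ 14 ∷ 41 ∷ 124 ∷ 385 ∷ 1220 ∷ 3929 ∷ 12822 ∷ [])
    × (∀ (n : ℕ) → 1 ≤ n →
    HasCardinality (ℳ′-avoiding (n ∸ 1) Z₁) (a n)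
    × HasCardinality (ℳ′-avoiding (n ∸ 1) Z₂) (a n)
    × HasCardinality (ℳ′-avoiding (n ∸ 1) Z₃) (a n)))
theorem13 =
  (λ n 1≤n → toMotzkin-bijective 1≤n detects₁ (captures₁ 1F 1F 1F) ,
             toMotzkin-bijective 1≤n detects₂ (captures₂ 1F 1F 1F) ,
             toMotzkin-bijective 1≤n detects₃ (captures₃ 1F 1F)) ,
  (λ n T → (λ x y z → captures⇒𝒯-avoiding-⇔ {Bad = Bad₁} (captures₁ 1F 1F 1F) (captures₁ x y z)) ,
           (λ x y z → captures⇒𝒯-avoiding-⇔ {Bad = Bad₂} (captures₂ 1F 1F 1F) (captures₂ x y z)) ,
           (λ x y → captures⇒𝒯-avoiding-⇔ {Bad = Bad₃} (captures₃ 1F 1F) (captures₃ x y))) ,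
  codes , codes-isA159771 , refl ,
  λ n 1≤n → ℳ′-avoiding-cardinality detects₁ encoding₁ 1≤n ,
            ℳ′-avoiding-cardinality detects₂ encoding₂ 1≤n ,
            ℳ′-avoiding-cardinality detects₃ encoding₃ 1≤n
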